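{- Let $q = 3^h$ with $h \ge 1$ an integer. Then the polar space $O^+(10,q)$ contains a Cameron--Liebler set of generators with parameter $(q^2-1)q$.
   Context: $O^+(10,q)$ denotes the finite classical polar space of rank $5$ given by the totally singular subspaces of a nondegenerate hyperbolic quadratic form on $\mathbb{F}_q^{10}$. Its points are the totally singular $1$-spaces and its generators are the totally singular $5$-spaces. Each point lies in exactly $2(q+1)(q^2+1)(q^3+1)$ generators. A set $\mathcal{L}$ of generators of $O^+(10,q)$ is called a Cameron--Liebler set of generators if its characteristic vector (in the real vector space indexed by the generators) lies in the span of the characteristic vectors of the point-pencils, where the point-pencil of a point $P$ is the set of all generators containing $P$. Its parameter is the number $x$ with $|\mathcal{L}| = 2x(q+1)(q^2+1)(q^3+1)$. (Equivalently, for every generator $\pi$, the number of elements of $\mathcal{L}$ meeting $\pi$ trivially is $(x-\chi_{\mathcal{L}}(\pi))q^{6}$, where $\chi_{\mathcal{L}}(\pi)=1$ if $\pi\in\mathcal{L}$ and $0$ otherwise.) -}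

module Defs where

open import Algebra.Apartness.Bundles using (HeytingField; module HeytingCommutativeRing)
open import Algebra.Bundles using (CommutativeRing)
open import Data.Bool.Base using (Bool; T; if_then_else_)
open import Data.Bool.Properties using (T?)
open import Data.Fin.Base using (Fin; zero; suc)
open import Data.Fin.Properties using (all?)
open import Data.Nat.Base as ℕ using (ℕ)
open import Data.Product.Base using (Σ; ∃-syntax; _×_; _,_; proj₁; proj₂)
open import Data.Rational.Base as ℚ using (ℚ; 0ℚ; 1ℚ)
import Data.Rational.Properties as ℚₚ
open import Data.Vec.Functional as Vector using (Vector)
import Data.Vec.Functional.Relation.Binary.Equality.Setoid as VectorEquality
import Algebra.Properties.Monoid.Sum as Sum
open import Function.Base using (_∘_)
open import Function.Bundles using (Inverse)
open import Level using (Level; _⊔_)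
open import Relation.Binary.Bundles using (Setoid)
import Relation.Binary.Construct.On as On
open import Relation.Binary.PropositionalEquality as ≡ using (_≡_)
open import Relation.Nullary.Decidable using (Dec; does; map′)

HasCardinality : ∀ {a ℓ} → Setoid a ℓ → ℕ → Set (a ⊔ ℓ)
HasCardinality S n = Inverse S (≡.setoid (Fin n))

indicator : Bool → ℚ
indicator b = if b then 1ℚ else 0ℚ

-- On a finite carrier both _≈_ and invertibility are decidable, and then the
-- axioms of HeytingField force x # y to mean ¬ (x ≈ y).  So a HeytingField
-- with n elements is the same thing as a finite field of order n.

module LinearAlgebra {c ℓ₁ ℓ₂ : Level} (F : HeytingField c ℓ₁ ℓ₂) where

  commutativeRing : CommutativeRing c ℓ₁
  commutativeRing =
    HeytingCommutativeRing.commutativeRing (HeytingField.heytingCommutativeRing F)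

  open CommutativeRing commutativeRing hiding (zero)
  open VectorEquality setoid using (_≋_)
  open Sum +-monoid using (sum)

  V : ℕ → Set c
  V d = Vector Carrier d

  infixl 6 _⊕_
  infixr 7 _·_

  𝟎 : ∀ {d} → V d
  𝟎 = Vector.replicate _ 0#

  _⊕_ : ∀ {d} → V d → V d → V d
  _⊕_ = Vector.zipWith _+_

  _·_ : ∀ {d} → Carrier → V d → V d
  a · v = Vector.map (a *_) v

  combination : ∀ {d k} → Vector Carrier k → Vector (V d) k → V d
  combination a b j = sum (λ i → a i * b i j)

  -- All sets here are finite, so subsets are given by Boolean membership
  -- functions, compatible with the equality of vectors.

  record Subspace (d : ℕ) : Set (c ⊔ ℓ₁) where
    field
      member   : V d → Bool
      respects : ∀ {v w} → v ≋ w → member v ≡ member w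

    infix 4 ∋_
    ∋_ : V d → Set
    ∋ v = T (member v)

    field
      𝟎-closed : ∋ 𝟎
      ⊕-closed : ∀ {v w} → ∋ v → ∋ w → ∋ (v ⊕ w)
      ·-closed : ∀ a {v} → ∋ v → ∋ (a · v)

  open Subspace public using (member)

  infix 4 _∈_ _⊆_

  _∈_ : ∀ {d} → V d → Subspace d → Set
  v ∈ U = T (member U v)

  _⊆_ : ∀ {d} → Subspace d → Subspace d → Set c
  U ⊆ W = ∀ v → v ∈ U → v ∈ W

  record HasDimension {d} (U : Subspace d) (k : ℕ) : Set (c ⊔ ℓ₁) where
    field
      basis       : Vector (V d) k
      basis∈      : ∀ i → basis i ∈ U
      independent : ∀ a → combination a basis ≋ 𝟎 → ∀ i → a i ≈ 0#
      spanning    : ∀ v → v ∈ U → ∃[ a ] v ≋ combination a basis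

  combination∈ : ∀ {d k} (U : Subspace d) (a : Vector Carrier k) (b : Vector (V d) k) →
                 (∀ i → b i ∈ U) → combination a b ∈ U
  combination∈ {k = ℕ.zero}  U a b b∈U = Subspace.𝟎-closed U
  combination∈ {k = ℕ.suc k} U a b b∈U =
    Subspace.⊕-closed U (Subspace.·-closed U (a zero) (b∈U zero))
      (combination∈ U (a ∘ suc) (b ∘ suc) (b∈U ∘ suc))

  ⊆-dec : ∀ {d k} {U : Subspace d} → HasDimension U k → (W : Subspace d) → Dec (U ⊆ W)
  ⊆-dec {U = U} dim W = map′ to (λ U⊆W i → U⊆W (basis i) (basis∈ i))
                             (all? (λ i → T? (member W (basis i))))
    where
    open HasDimension dim
    to : (∀ i → basis i ∈ W) → U ⊆ W
    to b∈W v v∈U with spanning v v∈U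
    ... | a , v≋ = ≡.subst T (≡.sym (Subspace.respects W v≋)) (combination∈ W a basis b∈W)

  record QuadraticForm (d : ℕ) : Set (c ⊔ ℓ₁) where
    field
      form        : V d → Carrier
      form-cong   : ∀ {v w} → v ≋ w → form v ≈ form w
      homogeneous : ∀ a v → form (a · v) ≈ a * a * form v

    polar : V d → V d → Carrier
    polar v w = form (v ⊕ w) - form v - form w

    -- Linearity in the second argument follows by symmetry of polar.
    field
      polar-additive    : ∀ u v w → polar (u ⊕ v) w ≈ polar u w + polar v w
      polar-homogeneous : ∀ a v w → polar (a · v) w ≈ a * polar v w

  Nondegenerate : ∀ {d} → QuadraticForm d → Set (c ⊔ ℓ₁)
  Nondegenerate Q = ∀ v → form v ≈ 0# → (∀ w → polar v w ≈ 0#) → v ≋ 𝟎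
    where open QuadraticForm Q

  TotallySingular : ∀ {d} → QuadraticForm d → Subspace d → Set (c ⊔ ℓ₁)
  TotallySingular Q U = ∀ v → v ∈ U → QuadraticForm.form Q v ≈ 0#

  record SingularSpace {d} (Q : QuadraticForm d) (k : ℕ) : Set (c ⊔ ℓ₁) where
    field
      space     : Subspace d
      dimension : HasDimension space k
      singular  : TotallySingular Q space

  -- Hyperbolic type: a form on a 2r-dimensional space whose Witt index is r,
  -- the largest possible for a nondegenerate form.
  Hyperbolic : (r : ℕ) → QuadraticForm (2 ℕ.* r) → Set (c ⊔ ℓ₁)
  Hyperbolic r Q = SingularSpace Q r

  -- The chosen basis in a SingularSpace is irrelevant to its equality.
  singularSpaces : ∀ {d} → QuadraticForm d → ℕ → Setoid (c ⊔ ℓ₁) c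
  singularSpaces Q k = record
    { Carrier       = SingularSpace Q k
    ; _≈_           = λ U W → ∀ v → mem U v ≡ mem W v
    ; isEquivalence = record
      { refl  = λ _ → ≡.refl
      ; sym   = λ p v → ≡.sym (p v)
      ; trans = λ p q v → ≡.trans (p v) (q v)
      }
    }
    where
    mem : SingularSpace Q k → V _ → Bool
    mem U = member (SingularSpace.space U)

module O⁺10 {c ℓ₁ ℓ₂ : Level} (F : HeytingField c ℓ₁ ℓ₂)
            (Q : LinearAlgebra.QuadraticForm F 10) where

  open LinearAlgebra F

  Point : Set (c ⊔ ℓ₁)
  Point = SingularSpace Q 1

  Generator : Set (c ⊔ ℓ₁)
  Generator = SingularSpace Q 5

  generators : Setoid (c ⊔ ℓ₁) c
  generators = singularSpaces Q 5

  record GeneratorSet : Set (c ⊔ ℓ₁) where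
    field
      contains : Generator → Bool
      respects : ∀ {π ρ} → Setoid._≈_ generators π ρ → contains π ≡ contains ρ

    elements : Setoid (c ⊔ ℓ₁) c
    elements = On.setoid {B = Σ Generator (λ π → T (contains π))} generators proj₁

  χ : GeneratorSet → Generator → ℚ
  χ L π = indicator (GeneratorSet.contains L π)

  χ-pencil : Point → Generator → ℚ
  χ-pencil P π =
    indicator (does (⊆-dec (SingularSpace.dimension P) (SingularSpace.space π)))

  -- The vectors involved are 0/1-valued, so lying in their real span is the same
  -- as lying in their rational span.
  IsCameronLiebler : GeneratorSet → Set (c ⊔ ℓ₁)
  IsCameronLiebler L =
    ∃[ n ] Σ (Vector ℚ n) λ a → Σ (Vector Point n) λ P →
      ∀ π → χ L π ≡ ∑[ i < n ] (a i ℚ.* χ-pencil (P i) π)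
    where open Sum ℚₚ.+-0-monoid using (sum-syntax)

  -- q is the order of F.
  HasParameter : (q : ℕ) → GeneratorSet → (x : ℕ) → Set (c ⊔ ℓ₁)
  HasParameter q L x =
    HasCardinality (GeneratorSet.elements L)
      (2 ℕ.* x ℕ.* (q ℕ.+ 1) ℕ.* (q ℕ.^ 2 ℕ.+ 1) ℕ.* (q ℕ.^ 3 ℕ.+ 1))

-- Pairwise non-orthogonal singular points P₁, …, Pₘ lie on pairwise disjoint sets of
-- generators, so the union of their pencils is a Cameron–Liebler set of parameter m.
-- For q = 3ʰ the Hermitian unital in PG(2, q²), mapped into the parabolic quadric
-- Q(6, q), gives q³ such points; any q³ - q of them will do.
--
-- A generator U of a hyperbolic space H ⊥ ⟨e, f⟩ of rank r + 1 is determined by the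
-- generator U′ of H obtained by projecting U ∩ e^⊥ and by one more choice: either
-- e ∈ U, or a linear functional on U′. This gives 1 + q^r possibilities over each U′.
-- The generators through e are those of the first kind, so their number is
-- (1 + 1)(1 + q)(1 + q²)(1 + q³) in rank 5.

module Submission where

open import Defs
open import Algebra.Apartness.Bundles using (HeytingField)
open import Algebra.Bundles using (CommutativeRing; RawRing)
import Algebra.Properties.Monoid.Sum as Sum
open import Algebra.Solver.Ring.AlmostCommutativeRing using (_-Raw-AlmostCommutative⟶_; fromCommutativeRing)
open import Data.Bool.Base using (Bool; T)
open import Data.Bool.Properties using (T?)
open import Data.Empty using (⊥)
open import Data.Fin.Base as Fin using (Fin; zero; suc; combine; remQuot; funToFin; finToFun; inject≤)
open import Data.Fin.Permutation using (Permutation; permutation)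
import Data.Fin.Properties as Fin
open import Data.Integer.Base as ℤ using (ℤ; +_; -[1+_])
import Data.Integer.Properties as ℤ
open import Data.Maybe.Base as Maybe using (Maybe)
open import Data.Nat.Base as ℕ using (ℕ; _≤_; _<_; _*_; _∸_; _^_)
import Data.Nat.Properties as ℕ
import Data.Nat.Solver as ℕ
open import Data.Product.Base using (Σ; ∃; ∃-syntax; _×_; _,_; proj₁; proj₂)
open import Data.Product.Function.NonDependent.Propositional using (_×-↔_)
open import Data.Rational.Base as ℚ using (ℚ; 1ℚ)
import Data.Rational.Properties as ℚ
open import Data.Sign.Base as Sign using (Sign)
open import Data.Sum.Base using (_⊎_; inj₁; inj₂; [_,_])
open import Data.Unit.Base using (⊤; tt)
open import Data.Vec.Functional using (Vector; _∷_; tail)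
open import Function.Base using (_∘_; id)
open import Function.Bundles using (Inverse)
open import Function.Construct.Identity using (↔-id)
open import Function.Properties.Inverse using (↔-refl; ↔-sym; ↔-trans)
open import Level using (Level; _⊔_)
open import Relation.Binary.Bundles using (Setoid)
import Relation.Binary.Construct.On as On
open import Relation.Binary.Definitions using (Decidable; _Respects_)
open import Relation.Binary.PropositionalEquality as ≡ using (_≡_)
open import Relation.Nullary.Decidable
  using (Dec; does; True; isYes; yes; no; map′; ¬?; _×-dec_; decidable-stable; dec⇒maybe; toWitness; fromWitness)
open import Relation.Nullary.Negation using (¬_; contradiction)

-- Over an abstract field, `Q` comes with nothing but nondegeneracy and one totally singular
-- 5-space, so coordinates have to be built. Completing that 5-space to hyperbolic pairs identifies
-- `Q` with a sum of five hyperbolic planes; only the polar form is used, never division by 2.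
-- Counting vectors replaces dimension theory: an injective isometry between spaces of equal size is
-- onto, and a space that is too large cannot embed.
--
-- With one hyperbolic pair e, f split off, the singular points not orthogonal to f are spanned by
-- the vectors e + w - Q(w) f, and two of them are orthogonal exactly when Q(w - w′) = 0. The points
-- needed are thus vectors of `H 4` with pairwise nonsingular differences. Each such point is the
-- image of e under a Siegel transformation, so it suffices to classify the generators through e.
--
-- Characteristic 3 matters because the identity matrix of order 3 then has trace zero: the scalars
-- can be divided out of the trace-zero Hermitian matrices, and the difference form on the unital
-- becomes a norm whose first argument is itself a norm, up to a multiple of 3.

T-extensional : ∀ {a b} → (T a → T b) → (T b → T a) → a ≡ b
T-extensional {Bool.false} {Bool.false} f g = ≡.refl
T-extensional {Bool.false} {Bool.true}  f g = contradiction tt g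
T-extensional {Bool.true}  {Bool.false} f g = contradiction tt f
T-extensional {Bool.true}  {Bool.true}  f g = ≡.refl

does⇒ : ∀ {p} {P : Set p} (P? : Dec P) → T (does P?) → P
does⇒ (yes p) _ = p

⇒does : ∀ {p} {P : Set p} (P? : Dec P) → P → T (does P?)
⇒does (yes _) _ = tt
⇒does (no ¬p) p = contradiction p ¬p

-- If the first set holds, disjointness rules out all the others, and the remaining sum is the case
-- `Bool.false` of the induction; otherwise the first term vanishes. The coefficients `1ℚ` match the
-- linear combination in `IsCameronLiebler`.
indicator-disjoint-union : ∀ {m} (B : Bool) (b : Fin m → Bool) → (T B → ∃[ i ] T (b i)) → (∀ i → T (b i) → T B) →
  (∀ i j → T (b i) → T (b j) → i ≡ j) → indicator B ≡ Sum.sum ℚ.+-0-monoid (λ i → 1ℚ ℚ.* indicator (b i))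
indicator-disjoint-union {ℕ.zero} Bool.false b covered contains disjoint = ≡.refl
indicator-disjoint-union {ℕ.zero} Bool.true  b covered contains disjoint = contradiction (proj₁ (covered tt)) λ ()
indicator-disjoint-union {ℕ.suc m} B b covered contains disjoint = split (b zero) ≡.refl
  where
  rest-sum : ℚ
  rest-sum = Sum.sum ℚ.+-0-monoid (λ i → 1ℚ ℚ.* indicator (b (suc i)))
  tail-disjoint : ∀ i j → T (b (suc i)) → T (b (suc j)) → i ≡ j
  tail-disjoint i j bi bj = Fin.suc-injective (disjoint (suc i) (suc j) bi bj)
  split : ∀ b₀ → b zero ≡ b₀ → indicator B ≡ 1ℚ ℚ.* indicator (b zero) ℚ.+ rest-sum
  split Bool.true b₀≡ = begin
    indicator B                                       ≡⟨ ≡.cong indicator (T-extensional {B} {Bool.true} (λ _ → tt) (λ _ → contains zero b₀)) ⟩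
    1ℚ ℚ.* indicator Bool.true ℚ.+ indicator Bool.false
      ≡⟨ ≡.cong₂ (λ x y → 1ℚ ℚ.* indicator x ℚ.+ y) (≡.sym b₀≡)
           (indicator-disjoint-union Bool.false (b ∘ suc) (λ ())
             (λ i bi → contradiction (disjoint zero (suc i) b₀ bi) λ ()) tail-disjoint) ⟩
    1ℚ ℚ.* indicator (b zero) ℚ.+ rest-sum            ∎
    where
    open ≡.≡-Reasoning
    b₀ : T (b zero)
    b₀ = ≡.subst T (≡.sym b₀≡) tt
  split Bool.false b₀≡ = begin
    indicator B                                       ≡⟨ indicator-disjoint-union B (b ∘ suc) tail-covered (contains ∘ suc) tail-disjoint ⟩
    rest-sum                                          ≡⟨ ℚ.+-identityˡ rest-sum ⟨
    1ℚ ℚ.* indicator Bool.false ℚ.+ rest-sum          ≡⟨ ≡.cong (λ x → 1ℚ ℚ.* indicator x ℚ.+ rest-sum) b₀≡ ⟨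
    1ℚ ℚ.* indicator (b zero) ℚ.+ rest-sum            ∎
    where
    open ≡.≡-Reasoning
    tail-covered : T B → ∃[ i ] T (b (suc i))
    tail-covered B∋ with covered B∋
    ... | zero  , b₀ = contradiction (≡.subst T b₀≡ b₀) λ ()
    ... | suc i , bi = i , bi

-- The ring solver needs coefficients with decidable equality, hence ℤ rather than R itself.
module IntegerSolver {c ℓ : Level} (R : CommutativeRing c ℓ) where

  open CommutativeRing R renaming (_*_ to _∙_)
  open import Algebra.Properties.Semiring.Mult.TCOptimised semiring
    using (×-homo-+; ×1-homo-*) renaming (_×_ to _⋆_)
  open import Algebra.Properties.Ring ring using (-0#≈0#; -‿distribˡ-*; -‿distribʳ-*; -‿+-comm; -‿involutive)
  open import Relation.Binary.Reasoning.Setoid setoid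

  ⟦_⟧ : ℤ → Carrier
  ⟦ + n ⟧      = n ⋆ 1#
  ⟦ -[1+ n ] ⟧ = - (ℕ.suc n ⋆ 1#)

  signed : Sign → Carrier → Carrier
  signed Sign.+ x = x
  signed Sign.- x = - x

  signed-cong : ∀ s {x y} → x ≈ y → signed s x ≈ signed s y
  signed-cong Sign.+ x≈y = x≈y
  signed-cong Sign.- x≈y = -‿cong x≈y

  signed-* : ∀ s t x y → signed (s Sign.* t) (x ∙ y) ≈ signed s x ∙ signed t y
  signed-* Sign.+ Sign.+ x y = refl
  signed-* Sign.+ Sign.- x y = -‿distribʳ-* x y
  signed-* Sign.- Sign.+ x y = -‿distribˡ-* x y
  signed-* Sign.- Sign.- x y = begin
    x ∙ y          ≈⟨ -‿involutive _ ⟨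
    - - (x ∙ y)    ≈⟨ -‿cong (-‿distribʳ-* x y) ⟩
    - (x ∙ - y)    ≈⟨ -‿distribˡ-* x (- y) ⟩
    - x ∙ - y      ∎

  ◃-homo : ∀ s n → ⟦ s ℤ.◃ n ⟧ ≈ signed s (n ⋆ 1#)
  ◃-homo Sign.+ ℕ.zero    = refl
  ◃-homo Sign.- ℕ.zero    = sym -0#≈0#
  ◃-homo Sign.+ (ℕ.suc n) = refl
  ◃-homo Sign.- (ℕ.suc n) = refl

  sign-abs : ∀ i → ⟦ i ⟧ ≈ signed (ℤ.sign i) (ℤ.∣ i ∣ ⋆ 1#)
  sign-abs (+ n)      = refl
  sign-abs (-[1+ n ]) = refl

  *-homo : ∀ i j → ⟦ i ℤ.* j ⟧ ≈ ⟦ i ⟧ ∙ ⟦ j ⟧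
  *-homo i j = begin
    ⟦ i ℤ.* j ⟧
      ≈⟨ ◃-homo (ℤ.sign i Sign.* ℤ.sign j) (ℤ.∣ i ∣ ℕ.* ℤ.∣ j ∣) ⟩
    signed (ℤ.sign i Sign.* ℤ.sign j) ((ℤ.∣ i ∣ ℕ.* ℤ.∣ j ∣) ⋆ 1#)
      ≈⟨ signed-cong (ℤ.sign i Sign.* ℤ.sign j) (×1-homo-* ℤ.∣ i ∣ ℤ.∣ j ∣) ⟩
    signed (ℤ.sign i Sign.* ℤ.sign j) ((ℤ.∣ i ∣ ⋆ 1#) ∙ (ℤ.∣ j ∣ ⋆ 1#))
      ≈⟨ signed-* (ℤ.sign i) (ℤ.sign j) _ _ ⟩
    signed (ℤ.sign i) (ℤ.∣ i ∣ ⋆ 1#) ∙ signed (ℤ.sign j) (ℤ.∣ j ∣ ⋆ 1#)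
      ≈⟨ *-cong (sign-abs i) (sign-abs j) ⟨
    ⟦ i ⟧ ∙ ⟦ j ⟧ ∎

  ⊖-homo : ∀ m n → ⟦ m ℤ.⊖ n ⟧ ≈ m ⋆ 1# + - (n ⋆ 1#)
  ⊖-homo m         ℕ.zero    = sym (trans (+-congˡ -0#≈0#) (+-identityʳ _))
  ⊖-homo ℕ.zero    (ℕ.suc n) = sym (+-identityˡ _)
  ⊖-homo (ℕ.suc m) (ℕ.suc n) = begin
    ⟦ ℕ.suc m ℤ.⊖ ℕ.suc n ⟧
      ≡⟨ ≡.cong ⟦_⟧ (ℤ.[1+m]⊖[1+n]≡m⊖n m n) ⟩
    ⟦ m ℤ.⊖ n ⟧
      ≈⟨ ⊖-homo m n ⟩
    m ⋆ 1# + - (n ⋆ 1#)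
      ≈⟨ +-congʳ (+-identityʳ _) ⟨
    m ⋆ 1# + 0# + - (n ⋆ 1#)
      ≈⟨ +-congʳ (+-congˡ (-‿inverseʳ 1#)) ⟨
    m ⋆ 1# + (1# + - 1#) + - (n ⋆ 1#)
      ≈⟨ +-congʳ (+-assoc _ _ _) ⟨
    m ⋆ 1# + 1# + - 1# + - (n ⋆ 1#)
      ≈⟨ +-assoc _ _ _ ⟩
    m ⋆ 1# + 1# + (- 1# + - (n ⋆ 1#))
      ≈⟨ +-cong (+-comm _ _) (-‿+-comm 1# (n ⋆ 1#)) ⟩
    1# + m ⋆ 1# + - (1# + n ⋆ 1#)
      ≈⟨ +-cong (×-homo-+ 1# 1 m) (-‿cong (×-homo-+ 1# 1 n)) ⟨
    ℕ.suc m ⋆ 1# + - (ℕ.suc n ⋆ 1#) ∎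

  +-homo : ∀ i j → ⟦ i ℤ.+ j ⟧ ≈ ⟦ i ⟧ + ⟦ j ⟧
  +-homo (+ m)      (+ n)      = ×-homo-+ 1# m n
  +-homo (+ m)      (-[1+ n ]) = ⊖-homo m (ℕ.suc n)
  +-homo (-[1+ m ]) (+ n)      = trans (⊖-homo n (ℕ.suc m)) (+-comm _ _)
  +-homo (-[1+ m ]) (-[1+ n ]) = begin
    - (ℕ.suc (ℕ.suc (m ℕ.+ n)) ⋆ 1#)
      ≡⟨ ≡.cong (λ k → - (ℕ.suc k ⋆ 1#)) (ℕ.+-suc m n) ⟨
    - ((ℕ.suc m ℕ.+ ℕ.suc n) ⋆ 1#)
      ≈⟨ -‿cong (×-homo-+ 1# (ℕ.suc m) (ℕ.suc n)) ⟩
    - (ℕ.suc m ⋆ 1# + ℕ.suc n ⋆ 1#)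
      ≈⟨ -‿+-comm _ _ ⟨
    - (ℕ.suc m ⋆ 1#) + - (ℕ.suc n ⋆ 1#) ∎

  -‿homo : ∀ i → ⟦ ℤ.- i ⟧ ≈ - ⟦ i ⟧
  -‿homo (+ ℕ.zero)    = sym -0#≈0#
  -‿homo (+ (ℕ.suc n)) = refl
  -‿homo (-[1+ n ])    = sym (-‿involutive _)

  ℤ-rawRing : RawRing _ _
  ℤ-rawRing = CommutativeRing.rawRing ℤ.+-*-commutativeRing

  homomorphism : ℤ-rawRing -Raw-AlmostCommutative⟶ fromCommutativeRing R
  homomorphism = record
    { ⟦_⟧    = ⟦_⟧
    ; +-homo = +-homo
    ; *-homo = *-homo
    ; -‿homo = -‿homo
    ; 0-homo = refl
    ; 1-homo = refl
    }

  coefficient≟ : ∀ i j → Maybe (⟦ i ⟧ ≈ ⟦ j ⟧)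
  coefficient≟ i j = Maybe.map (reflexive ∘ ≡.cong ⟦_⟧) (dec⇒maybe (i ℤ.≟ j))

  open import Algebra.Solver.Ring ℤ-rawRing (fromCommutativeRing R) homomorphism coefficient≟ public
    using (solve; _:=_; _:+_; _:*_; _:-_; :-_; con)

-- Search and pigeonhole on finite setoids

module Finite {a ℓ : Level} (S : Setoid a ℓ) {n : ℕ} (S≅n : HasCardinality S n) where

  open Setoid S
  open Inverse S≅n

  infix 4 _≟_

  _≟_ : Decidable _≈_
  x ≟ y = map′ (λ eq → trans (sym (strictlyInverseʳ x)) (trans (from-cong eq) (strictlyInverseʳ y)))
               to-cong (to x Fin.≟ to y)

  exists? : ∀ {p} {P : Carrier → Set p} → P Respects _≈_ → (∀ x → Dec (P x)) → Dec (∃ P)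
  exists? resp P? = map′ (λ (i , p) → from i , p)
                         (λ (x , p) → to x , resp (sym (strictlyInverseʳ x)) p)
                         (Fin.any? (P? ∘ from))

module _ {a b ℓ₁ ℓ₂ : Level} {S : Setoid a ℓ₁} {T : Setoid b ℓ₂} where

  private
    module S = Setoid S
    module T = Setoid T

  injective⇒≤ : ∀ {m n} → HasCardinality S m → HasCardinality T n →
                (f : S.Carrier → T.Carrier) → (∀ {x y} → f x T.≈ f y → x S.≈ y) → m ≤ n
  injective⇒≤ S≅m T≅n f inj = Fin.injective⇒≤ {f = Tₙ.to ∘ f ∘ Sₘ.from} λ eq →
    ≡.trans (≡.sym (Sₘ.strictlyInverseˡ _)) (≡.trans
      (Sₘ.to-cong (inj (T.trans (T.sym (Tₙ.strictlyInverseʳ _))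
        (T.trans (Tₙ.from-cong eq) (Tₙ.strictlyInverseʳ _)))))
      (Sₘ.strictlyInverseˡ _))
    where
    module Sₘ = Inverse S≅m
    module Tₙ = Inverse T≅n

  -- Pigeonhole: a missed y, put in front of the values of f, would inject `Fin (suc n)` into n
  -- elements.
  injective⇒surjective : ∀ {n} → HasCardinality S n → HasCardinality T n →
                         (f : S.Carrier → T.Carrier) →
                         (∀ {x y} → x S.≈ y → f x T.≈ f y) →
                         (∀ {x y} → f x T.≈ f y → x S.≈ y) →
                         ∀ y → ∃[ x ] f x T.≈ y
  injective⇒surjective {n} S≅n T≅n f f-cong inj y
    with Finite.exists? S S≅n (λ x≈x′ fx≈y → T.trans (f-cong (S.sym x≈x′)) fx≈y) (λ x → Finite._≟_ T T≅n (f x) y)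
  ... | yes hit = hit
  ... | no miss = contradiction (Fin.injective⇒≤ {f = Tₙ.to ∘ extended} (λ {i} {j} → extended-injective i j ∘ to-injective)) ℕ.1+n≰n
    where
    module Sₙ = Inverse S≅n
    module Tₙ = Inverse T≅n
    extended : Fin (ℕ.suc n) → T.Carrier
    extended zero    = y
    extended (suc i) = f (Sₙ.from i)
    to-injective : ∀ {x x′} → Tₙ.to x ≡ Tₙ.to x′ → x T.≈ x′
    to-injective eq = T.trans (T.sym (Tₙ.strictlyInverseʳ _)) (T.trans (Tₙ.from-cong eq) (Tₙ.strictlyInverseʳ _))
    extended-injective : ∀ i j → extended i T.≈ extended j → i ≡ j
    extended-injective zero    zero    eq = ≡.refl
    extended-injective zero    (suc j) eq = contradiction (_ , T.sym eq) miss
    extended-injective (suc i) zero    eq = contradiction (_ , eq) miss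
    extended-injective (suc i) (suc j) eq = ≡.cong suc (≡.trans (≡.sym (Sₙ.strictlyInverseˡ i))
      (≡.trans (Sₙ.to-cong (inj eq)) (Sₙ.strictlyInverseˡ j)))

  cardinality-transfer : ∀ {n} → HasCardinality S n → (f : S.Carrier → T.Carrier) →
                         (∀ {x y} → x S.≈ y → f x T.≈ f y) →
                         (∀ {x y} → f x T.≈ f y → x S.≈ y) →
                         (∀ y → ∃[ x ] f x T.≈ y) → HasCardinality T n
  cardinality-transfer S≅n f f-cong inj surj = record
    { to        = Sₙ.to ∘ preimage
    ; from      = f ∘ Sₙ.from
    ; to-cong   = to-cong
    ; from-cong = f-cong ∘ Sₙ.from-cong
    ; inverse   = (λ {i} {y} y≈ → ≡.trans (to-cong y≈) (≡.trans
                      (Sₙ.to-cong (inj (proj₂ (surj (f (Sₙ.from i)))))) (Sₙ.strictlyInverseˡ i)))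
                , (λ {y} {i} i≡ → T.trans (f-cong (S.trans (Sₙ.from-cong i≡) (Sₙ.strictlyInverseʳ _))) (proj₂ (surj y)))
    }
    where
    module Sₙ = Inverse S≅n
    preimage = λ y → proj₁ (surj y)
    to-cong : ∀ {y y′} → y T.≈ y′ → Sₙ.to (preimage y) ≡ Sₙ.to (preimage y′)
    to-cong y≈y′ = Sₙ.to-cong (inj (T.trans (proj₂ (surj _)) (T.trans y≈y′ (T.sym (proj₂ (surj _))))))

-- Arithmetic of a finite field

module FiniteField {c ℓ₁ ℓ₂ : Level} (F : HeytingField c ℓ₁ ℓ₂) (q : ℕ) (1<q : 1 < q)
  (F≅q : HasCardinality (CommutativeRing.setoid (LinearAlgebra.commutativeRing F)) q) where

  open LinearAlgebra F hiding (_⊕_; _·_; 𝟎)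
  open CommutativeRing commutativeRing hiding (zero) renaming (_*_ to _∙_)
  open import Algebra.Properties.CommutativeMonoid.Sum +-commutativeMonoid using (sum; sum-cong-≋)
  open IntegerSolver commutativeRing using (solve; _:=_; _:+_; _:*_; :-_; con)
  open import Relation.Binary.Reasoning.Setoid setoid

  open Finite setoid F≅q public using (_≟_) renaming (exists? to existsScalar?)

  -- A finite search decides invertibility. In a Heyting field an element apart from 0 is
  -- invertible, so a non-invertible one is not apart from 0 and equals 0 by tightness.
  inverse : ∀ {x} → ¬ x ≈ 0# → ∃[ y ] y ∙ x ≈ 1#
  inverse {x} x≉0 with existsScalar? {P = λ y → y ∙ x ≈ 1#} (λ y≈ → trans (*-congʳ (sym y≈))) (λ y → y ∙ x ≟ 1#)
  ... | yes invertible = invertible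
  ... | no  ¬invertible = contradiction (proj₁ (tight x 0#) λ x#0 → ¬invertible (invert (#⇒invertible x#0))) x≉0
    where
    open HeytingField F using (tight; #⇒invertible)
    invert : ∃[ y ] (y ∙ (x - 0#) ≈ 1#) × ((x - 0#) ∙ y ≈ 1#) → ∃[ y ] y ∙ x ≈ 1#
    invert (y , left , _) = y , trans
      (solve 2 (λ y x → y :* x := y :* (x :+ :- con (+ 0))) refl y x) left

  integral : ∀ {x y} → ¬ x ≈ 0# → x ∙ y ≈ 0# → y ≈ 0#
  integral {x} {y} x≉0 xy≈0 with inverse x≉0
  ... | x⁻¹ , x⁻¹x≈1 = begin
    y              ≈⟨ *-identityˡ y ⟨
    1# ∙ y         ≈⟨ *-congʳ x⁻¹x≈1 ⟨
    x⁻¹ ∙ x ∙ y    ≈⟨ *-assoc _ _ _ ⟩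
    x⁻¹ ∙ (x ∙ y)  ≈⟨ *-congˡ xy≈0 ⟩
    x⁻¹ ∙ 0#       ≈⟨ zeroʳ _ ⟩
    0#             ∎

  difference⇒≈ : ∀ {x y} → - 1# ∙ y + x ≈ 0# → x ≈ y
  difference⇒≈ {x} {y} eq = begin
    x                     ≈⟨ solve 2 (λ x y → x := :- con (+ 1) :* y :+ x :+ y) refl x y ⟩
    - 1# ∙ y + x + y      ≈⟨ +-congʳ eq ⟩
    0# + y                ≈⟨ +-identityˡ y ⟩
    y                     ∎

  -- If 1 were 0, all elements would coincide, yet `1 < q` provides two distinct indices.
  1≉0 : ¬ 1# ≈ 0#
  1≉0 1≈0 = contradiction
    (Fin.fromℕ<-injective 0 1 (ℕ.<-trans ℕ.z<s 1<q) 1<q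
      (≡.trans (≡.sym (strictlyInverseˡ _)) (≡.trans (to-cong (trivial _ _)) (strictlyInverseˡ _))))
    λ ()
    where
    open Inverse F≅q
    trivial : ∀ x y → x ≈ y
    trivial x y = begin
      x       ≈⟨ *-identityˡ x ⟨
      1# ∙ x  ≈⟨ *-congʳ 1≈0 ⟩
      0# ∙ x  ≈⟨ solve 2 (λ x y → con (+ 0) :* x := con (+ 0) :* y) refl x y ⟩
      0# ∙ y  ≈⟨ *-congʳ 1≈0 ⟨
      1# ∙ y  ≈⟨ *-identityˡ y ⟩
      y       ∎

  -- Quadratic forms over a finite field

  -- Vectors over an arbitrary index set, so that a hyperbolic space can keep its two halves apart
  -- as `Fin r ⊎ Fin r`; `Fun (Fin n)` is `V n`.
  Fun : Set → Set c
  Fun I = I → Carrier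

  infix 4 _≋_
  infixl 6 _⊕_
  infixr 7 _·_

  _≋_ : ∀ {I : Set} → Fun I → Fun I → Set ℓ₁
  x ≋ y = ∀ i → x i ≈ y i

  𝟎 : ∀ {I : Set} → Fun I
  𝟎 _ = 0#

  _⊕_ : ∀ {I : Set} → Fun I → Fun I → Fun I
  (x ⊕ y) i = x i + y i

  _·_ : ∀ {I : Set} → Carrier → Fun I → Fun I
  (a · x) i = a ∙ x i

  functions : Set → Setoid c ℓ₁
  functions I = record
    { Carrier       = Fun I
    ; _≈_           = _≋_
    ; isEquivalence = record
      { refl  = λ _ → refl
      ; sym   = λ x≋y i → sym (x≋y i)
      ; trans = λ x≋y y≋z i → trans (x≋y i) (y≋z i)
      }
    }

  module ≋ {I : Set} = Setoid (functions I)

  ⊕-cong : ∀ {I : Set} {w x y z : Fun I} → w ≋ x → y ≋ z → w ⊕ y ≋ x ⊕ z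
  ⊕-cong w≋x y≋z i = +-cong (w≋x i) (y≋z i)

  ·-cong : ∀ {I : Set} {a b} {x y : Fun I} → a ≈ b → x ≋ y → a · x ≋ b · y
  ·-cong a≈b x≋y i = *-cong a≈b (x≋y i)

  ⊕-identityʳ : ∀ {I : Set} (x : Fun I) → x ⊕ 𝟎 ≋ x
  ⊕-identityʳ x i = +-identityʳ (x i)

  vectors : ∀ n → HasCardinality (functions (Fin n)) (q ^ n)
  vectors n = record
    { to        = λ v → funToFin (to ∘ v)
    ; from      = λ i → from ∘ finToFun i
    ; to-cong   = λ v≋w → funToFin-cong (to-cong ∘ v≋w)
    ; from-cong = λ { ≡.refl _ → refl }
    ; inverse   = (λ {i} v≋ → ≡.trans (funToFin-cong (λ j → ≡.trans (to-cong (v≋ j)) (strictlyInverseˡ _)))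
                                      (Fin.funToFin-finToFin {n} i))
                , (λ { {v} ≡.refl j → trans (from-cong (Fin.finToFun-funToFin (to ∘ v) j)) (strictlyInverseʳ _) })
    }
    where
    open Inverse F≅q
    funToFin-cong : ∀ {m n} {f g : Fin m → Fin n} → (∀ i → f i ≡ g i) → funToFin f ≡ funToFin g
    funToFin-cong {ℕ.zero}  f≗g = ≡.refl
    funToFin-cong {ℕ.suc m} f≗g = ≡.cong₂ combine (f≗g zero) (funToFin-cong (f≗g ∘ suc))

  double : ∀ {m n} {I J : Set} → HasCardinality (functions I) m → HasCardinality (functions J) n →
           HasCardinality (functions (I ⊎ J)) (m ℕ.* n)
  double {m} {n} I≅m J≅n = record
    { to        = λ x → combine (I.to (x ∘ inj₁)) (J.to (x ∘ inj₂))
    ; from      = λ k → [ I.from (proj₁ (remQuot {m} n k)) , J.from (proj₂ (remQuot {m} n k)) ]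
    ; to-cong   = λ x≋y → ≡.cong₂ combine (I.to-cong (x≋y ∘ inj₁)) (J.to-cong (x≋y ∘ inj₂))
    ; from-cong = λ { ≡.refl _ → refl }
    ; inverse   = (λ {k} x≋ → ≡.trans (≡.cong₂ combine (I.inverseˡ (x≋ ∘ inj₁)) (J.inverseˡ (x≋ ∘ inj₂)))
                                      (Fin.combine-remQuot {m} n k))
                , (λ { ≡.refl (inj₁ i) → I.inverseʳ (≡.cong proj₁ (Fin.remQuot-combine _ _)) i
                     ; ≡.refl (inj₂ j) → J.inverseʳ (≡.cong proj₂ (Fin.remQuot-combine {m} _ _)) j })
    }
    where
    module I = Inverse I≅m
    module J = Inverse J≅n

  -- One law for a x + y carries both additivity and homogeneity, which are recovered below.
  record IsLinear {I J : Set} (f : Fun I → Fun J) : Set (c ⊔ ℓ₁) where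
    no-eta-equality
    field
      cong : ∀ {x y} → x ≋ y → f x ≋ f y
      axpy : ∀ a x y → f (a · x ⊕ y) ≋ a · f x ⊕ f y

    𝟎-homo : f 𝟎 ≋ 𝟎
    𝟎-homo i = begin
      f 𝟎 i                   ≈⟨ cong (λ _ → solve 0 (con (+ 0) := :- con (+ 1) :* con (+ 0) :+ con (+ 0)) refl) i ⟩
      f (- 1# · 𝟎 ⊕ 𝟎) i      ≈⟨ axpy (- 1#) 𝟎 𝟎 i ⟩
      - 1# ∙ f 𝟎 i + f 𝟎 i    ≈⟨ solve 1 (λ x → :- con (+ 1) :* x :+ x := con (+ 0)) refl (f 𝟎 i) ⟩
      0#                      ∎

    ·-homo : ∀ a x → f (a · x) ≋ a · f x
    ·-homo a x i = begin
      f (a · x) i          ≈⟨ cong (λ _ → sym (+-identityʳ _)) i ⟩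
      f (a · x ⊕ 𝟎) i      ≈⟨ axpy a x 𝟎 i ⟩
      a ∙ f x i + f 𝟎 i    ≈⟨ +-congˡ (𝟎-homo i) ⟩
      a ∙ f x i + 0#       ≈⟨ +-identityʳ _ ⟩
      a ∙ f x i            ∎

    ⊕-homo : ∀ x y → f (x ⊕ y) ≋ f x ⊕ f y
    ⊕-homo x y i = begin
      f (x ⊕ y) i          ≈⟨ cong (λ _ → +-congʳ (sym (*-identityˡ _))) i ⟩
      f (1# · x ⊕ y) i     ≈⟨ axpy 1# x y i ⟩
      1# ∙ f x i + f y i   ≈⟨ +-congʳ (*-identityˡ _) ⟩
      f x i + f y i        ∎

    trivialKernel⇒injective : (∀ x → f x ≋ 𝟎 → x ≋ 𝟎) → ∀ {x y} → f x ≋ f y → x ≋ y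
    trivialKernel⇒injective trivial {x} {y} fx≋fy i = difference⇒≈
      (trivial (- 1# · y ⊕ x) (λ j → begin
        f (- 1# · y ⊕ x) j      ≈⟨ axpy (- 1#) y x j ⟩
        - 1# ∙ f y j + f x j    ≈⟨ +-congˡ (fx≋fy j) ⟩
        - 1# ∙ f y j + f y j    ≈⟨ solve 1 (λ x → :- con (+ 1) :* x :+ x := con (+ 0)) refl (f y j) ⟩
        0#                      ∎) i)

  ∘-isLinear : ∀ {I J K : Set} {f : Fun J → Fun K} {g : Fun I → Fun J} →
               IsLinear f → IsLinear g → IsLinear (f ∘ g)
  ∘-isLinear f-lin g-lin = record
    { cong = f.cong ∘ g.cong
    ; axpy = λ a x y → ≋.trans (f.cong (g.axpy a x y)) (f.axpy a _ _)
    }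
    where
    module f = IsLinear f-lin
    module g = IsLinear g-lin

  -- The polar form is a field of its own, tied to `form` by `form-axpy`. Each instance can thus
  -- give it by a convenient formula, and the theory works in every characteristic.
  record Quadratic (I : Set) : Set (c ⊔ ℓ₁) where
    no-eta-equality
    field
      form      : Fun I → Carrier
      bil       : Fun I → Fun I → Carrier
      form-cong : ∀ {x y} → x ≋ y → form x ≈ form y
      bil-cong  : ∀ {w x y z} → w ≋ x → y ≋ z → bil w y ≈ bil x z
      bil-axpyˡ : ∀ a x y z → bil (a · x ⊕ y) z ≈ a ∙ bil x z + bil y z
      bil-sym   : ∀ x y → bil x y ≈ bil y x
      form-axpy : ∀ a x y → form (a · x ⊕ y) ≈ a ∙ a ∙ form x + a ∙ bil x y + form y

    bil-axpyʳ : ∀ a x y z → bil z (a · x ⊕ y) ≈ a ∙ bil z x + bil z y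
    bil-axpyʳ a x y z = begin
      bil z (a · x ⊕ y)       ≈⟨ bil-sym _ _ ⟩
      bil (a · x ⊕ y) z       ≈⟨ bil-axpyˡ a x y z ⟩
      a ∙ bil x z + bil y z   ≈⟨ +-cong (*-congˡ (bil-sym x z)) (bil-sym y z) ⟩
      a ∙ bil z x + bil z y   ∎

    bil-𝟎ʳ : ∀ x → bil x 𝟎 ≈ 0#
    bil-𝟎ʳ x = begin
      bil x 𝟎                     ≈⟨ bil-cong ≋.refl (λ _ → solve 0 (con (+ 0) := :- con (+ 1) :* con (+ 0) :+ con (+ 0)) refl) ⟩
      bil x (- 1# · 𝟎 ⊕ 𝟎)        ≈⟨ bil-axpyʳ (- 1#) 𝟎 𝟎 x ⟩
      - 1# ∙ bil x 𝟎 + bil x 𝟎    ≈⟨ solve 1 (λ x → :- con (+ 1) :* x :+ x := con (+ 0)) refl (bil x 𝟎) ⟩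
      0#                          ∎

    bil-·ʳ : ∀ a x z → bil z (a · x) ≈ a ∙ bil z x
    bil-·ʳ a x z = begin
      bil z (a · x)          ≈⟨ bil-cong ≋.refl (λ _ → +-identityʳ _) ⟨
      bil z (a · x ⊕ 𝟎)      ≈⟨ bil-axpyʳ a x 𝟎 z ⟩
      a ∙ bil z x + bil z 𝟎  ≈⟨ +-congˡ (bil-𝟎ʳ z) ⟩
      a ∙ bil z x + 0#       ≈⟨ +-identityʳ _ ⟩
      a ∙ bil z x            ∎

    form-⊕ : ∀ x y → form (x ⊕ y) ≈ form x + bil x y + form y
    form-⊕ x y = begin
      form (x ⊕ y)         ≈⟨ form-cong (λ _ → +-congʳ (*-identityˡ _)) ⟨
      form (1# · x ⊕ y)    ≈⟨ form-axpy 1# x y ⟩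
      1# ∙ 1# ∙ form x + 1# ∙ bil x y + form y
        ≈⟨ solve 3 (λ x y z → con (+ 1) :* con (+ 1) :* x :+ con (+ 1) :* y :+ z := x :+ y :+ z) refl (form x) (bil x y) (form y) ⟩
      form x + bil x y + form y ∎

    form-𝟎 : form 𝟎 ≈ 0#
    form-𝟎 = begin
      form 𝟎
        ≈⟨ solve 1 (λ x → x := x :+ con (+ 0) :+ x :+ :- x) refl (form 𝟎) ⟩
      form 𝟎 + 0# + form 𝟎 - form 𝟎
        ≈⟨ +-congʳ (+-congʳ (+-congˡ (bil-𝟎ʳ 𝟎))) ⟨
      form 𝟎 + bil 𝟎 𝟎 + form 𝟎 - form 𝟎
        ≈⟨ +-congʳ (form-⊕ 𝟎 𝟎) ⟨
      form (𝟎 ⊕ 𝟎) - form 𝟎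
        ≈⟨ +-congʳ (form-cong (⊕-identityʳ 𝟎)) ⟩
      form 𝟎 - form 𝟎
        ≈⟨ -‿inverseʳ _ ⟩
      0# ∎

    -- Comes from expanding `form` at - x + x, which is zero.
    bil-self : ∀ x → bil x x ≈ form x + form x
    bil-self x = begin
      bil x x
        ≈⟨ solve 2 (λ f b → b := f :+ f :+ :- (:- con (+ 1) :* :- con (+ 1) :* f :+ :- con (+ 1) :* b :+ f)) refl (form x) (bil x x) ⟩
      form x + form x - (- 1# ∙ - 1# ∙ form x + - 1# ∙ bil x x + form x)
        ≈⟨ +-congˡ (-‿cong (form-axpy (- 1#) x x)) ⟨
      form x + form x - form (- 1# · x ⊕ x)
        ≈⟨ +-congˡ (-‿cong (form-cong λ i → solve 1 (λ x → :- con (+ 1) :* x :+ x := con (+ 0)) refl (x i))) ⟩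
      form x + form x - form 𝟎
        ≈⟨ +-congˡ (-‿cong form-𝟎) ⟩
      form x + form x - 0#
        ≈⟨ solve 1 (λ f → f :+ f :+ :- con (+ 0) := f :+ f) refl (form x) ⟩
      form x + form x ∎

    form-· : ∀ a x → form (a · x) ≈ a ∙ a ∙ form x
    form-· a x = begin
      form (a · x)        ≈⟨ form-cong (⊕-identityʳ _) ⟨
      form (a · x ⊕ 𝟎)    ≈⟨ form-axpy a x 𝟎 ⟩
      a ∙ a ∙ form x + a ∙ bil x 𝟎 + form 𝟎
        ≈⟨ +-cong (+-congˡ (*-congˡ (bil-𝟎ʳ x))) form-𝟎 ⟩
      a ∙ a ∙ form x + a ∙ 0# + 0#
        ≈⟨ solve 2 (λ a f → a :* a :* f :+ a :* con (+ 0) :+ con (+ 0) := a :* a :* f) refl a (form x) ⟩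
      a ∙ a ∙ form x ∎

  -- An isometric embedding. Injectivity on a hyperbolic space follows from nondegeneracy, and
  -- surjectivity from counting.
  record Isometry {I J : Set} (P : Quadratic I) (Q : Quadratic J) : Set (c ⊔ ℓ₁) where
    no-eta-equality
    private
      module P = Quadratic P
      module Q = Quadratic Q
    field
      fun       : Fun I → Fun J
      isLinear  : IsLinear fun
      isometric : ∀ x → Q.form (fun x) ≈ P.form x

    open IsLinear isLinear public

    bil-preserving : ∀ x y → Q.bil (fun x) (fun y) ≈ P.bil x y
    bil-preserving x y = begin
      Q.bil (fun x) (fun y)
        ≈⟨ solve 3 (λ f b g → b := f :+ b :+ g :+ :- f :+ :- g) refl (Q.form (fun x)) (Q.bil (fun x) (fun y)) (Q.form (fun y)) ⟩
      Q.form (fun x) + Q.bil (fun x) (fun y) + Q.form (fun y) - Q.form (fun x) - Q.form (fun y)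
        ≈⟨ +-cong (+-cong (Q.form-⊕ (fun x) (fun y)) refl) refl ⟨
      Q.form (fun x ⊕ fun y) - Q.form (fun x) - Q.form (fun y)
        ≈⟨ +-cong (+-cong (Q.form-cong (⊕-homo x y)) refl) refl ⟨
      Q.form (fun (x ⊕ y)) - Q.form (fun x) - Q.form (fun y)
        ≈⟨ +-cong (+-cong (isometric _) (-‿cong (isometric _))) (-‿cong (isometric _)) ⟩
      P.form (x ⊕ y) - P.form x - P.form y
        ≈⟨ +-congʳ (+-congʳ (P.form-⊕ x y)) ⟩
      P.form x + P.bil x y + P.form y - P.form x - P.form y
        ≈⟨ solve 3 (λ f b g → b := f :+ b :+ g :+ :- f :+ :- g) refl (P.form x) (P.bil x y) (P.form y) ⟨
      P.bil x y ∎

  infixr 9 _∘ᵢ_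

  _∘ᵢ_ : ∀ {I J K : Set} {P : Quadratic I} {Q : Quadratic J} {R : Quadratic K} →
         Isometry Q R → Isometry P Q → Isometry P R
  f ∘ᵢ g = record
    { fun       = f.fun ∘ g.fun
    ; isLinear  = ∘-isLinear f.isLinear g.isLinear
    ; isometric = λ x → trans (f.isometric _) (g.isometric x)
    }
    where
    module f = Isometry f
    module g = Isometry g

  -- The standard hyperbolic space `H r`

  dot : ∀ {r} → V r → V r → Carrier
  dot u v = sum (λ i → u i ∙ v i)

  dot-cong : ∀ {r} {u u′ v v′ : V r} → u ≋ u′ → v ≋ v′ → dot u v ≈ dot u′ v′
  dot-cong u≋ v≋ = sum-cong-≋ (λ i → *-cong (u≋ i) (v≋ i))

  dot-comm : ∀ {r} (u v : V r) → dot u v ≈ dot v u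
  dot-comm u v = sum-cong-≋ (λ i → *-comm (u i) (v i))

  dot-axpyˡ : ∀ {r} a (u v w : V r) → dot (a · u ⊕ v) w ≈ a ∙ dot u w + dot v w
  dot-axpyˡ {ℕ.zero}  a u v w = solve 1 (λ a → con (+ 0) := a :* con (+ 0) :+ con (+ 0)) refl a
  dot-axpyˡ {ℕ.suc r} a u v w = begin
    (a ∙ u zero + v zero) ∙ w zero + dot (a · tail u ⊕ tail v) (tail w)
      ≈⟨ +-congˡ (dot-axpyˡ a (tail u) (tail v) (tail w)) ⟩
    (a ∙ u zero + v zero) ∙ w zero + (a ∙ dot (tail u) (tail w) + dot (tail v) (tail w))
      ≈⟨ solve 6 (λ a u v w d e → (a :* u :+ v) :* w :+ (a :* d :+ e) := a :* (u :* w :+ d) :+ (v :* w :+ e))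
           refl a (u zero) (v zero) (w zero) _ _ ⟩
    a ∙ dot u w + dot v w ∎

  dot-axpyʳ : ∀ {r} a (u v w : V r) → dot w (a · u ⊕ v) ≈ a ∙ dot w u + dot w v
  dot-axpyʳ a u v w = begin
    dot w (a · u ⊕ v)       ≈⟨ dot-comm w _ ⟩
    dot (a · u ⊕ v) w       ≈⟨ dot-axpyˡ a u v w ⟩
    a ∙ dot u w + dot v w   ≈⟨ +-cong (*-congˡ (dot-comm u w)) (dot-comm v w) ⟩
    a ∙ dot w u + dot w v   ∎

  dot-𝟎ˡ : ∀ {r} (v : V r) → dot 𝟎 v ≈ 0#
  dot-𝟎ˡ {ℕ.zero}  v = refl
  dot-𝟎ˡ {ℕ.suc r} v = trans (+-cong (zeroˡ _) (dot-𝟎ˡ (tail v))) (+-identityˡ 0#)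

  dot-𝟎ʳ : ∀ {r} (v : V r) → dot v 𝟎 ≈ 0#
  dot-𝟎ʳ v = trans (dot-comm v 𝟎) (dot-𝟎ˡ v)

  ∷-cong : ∀ {r} {a b} {u v : V r} → a ≈ b → u ≋ v → (a ∷ u) ≋ (b ∷ v)
  ∷-cong a≈b u≋v zero    = a≈b
  ∷-cong a≈b u≋v (suc i) = u≋v i

  ∷-η : ∀ {r} (v : V (ℕ.suc r)) → (v zero ∷ tail v) ≋ v
  ∷-η v zero    = refl
  ∷-η v (suc i) = refl

  ∷-axpy : ∀ {r} a s t (u v : V r) → (a ∙ s + t ∷ a · u ⊕ v) ≋ a · (s ∷ u) ⊕ (t ∷ v)
  ∷-axpy a s t u v zero    = refl
  ∷-axpy a s t u v (suc i) = refl

  dot-nondegenerate : ∀ {r} (v : V r) → (∀ u → dot u v ≈ 0#) → v ≋ 𝟎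
  dot-nondegenerate {ℕ.suc r} v ⊥v zero    = begin
    v zero                            ≈⟨ *-identityˡ _ ⟨
    1# ∙ v zero                       ≈⟨ +-identityʳ _ ⟨
    1# ∙ v zero + 0#                  ≈⟨ +-congˡ (dot-𝟎ˡ (tail v)) ⟨
    1# ∙ v zero + dot 𝟎 (tail v)      ≈⟨ ⊥v (1# ∷ 𝟎) ⟩
    0#                                ∎
  dot-nondegenerate {ℕ.suc r} v ⊥v (suc i) = dot-nondegenerate (tail v) (λ u → begin
    dot u (tail v)                    ≈⟨ +-identityˡ _ ⟨
    0# + dot u (tail v)               ≈⟨ +-congʳ (zeroˡ _) ⟨
    0# ∙ v zero + dot u (tail v)      ≈⟨ ⊥v (0# ∷ u) ⟩
    0#                                ∎) i

  H : ℕ → Set c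
  H r = Fun (Fin r ⊎ Fin r)

  left right : ∀ {r} → H r → V r
  left  x = x ∘ inj₁
  right x = x ∘ inj₂

  hyperbolic : ∀ r → Quadratic (Fin r ⊎ Fin r)
  hyperbolic r .Quadratic.form x = dot (left x) (right x)
  hyperbolic r .Quadratic.bil x y = dot (left x) (right y) + dot (left y) (right x)
  hyperbolic r .Quadratic.form-cong x≋y = dot-cong (x≋y ∘ inj₁) (x≋y ∘ inj₂)
  hyperbolic r .Quadratic.bil-cong w≋x y≋z =
    +-cong (dot-cong (w≋x ∘ inj₁) (y≋z ∘ inj₂)) (dot-cong (y≋z ∘ inj₁) (w≋x ∘ inj₂))
  hyperbolic r .Quadratic.bil-axpyˡ a x y z = trans
    (+-cong (dot-axpyˡ a (left x) (left y) (right z)) (dot-axpyʳ a (right x) (right y) (left z)))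
    (solve 5 (λ a p q r s → (a :* p :+ q) :+ (a :* r :+ s) := a :* (p :+ r) :+ (q :+ s)) refl a _ _ _ _)
  hyperbolic r .Quadratic.bil-sym x y = +-comm _ _
  hyperbolic r .Quadratic.form-axpy a x y = begin
    dot (a · left x ⊕ left y) (a · right x ⊕ right y)
      ≈⟨ dot-axpyˡ a (left x) (left y) _ ⟩
    a ∙ dot (left x) (a · right x ⊕ right y) + dot (left y) (a · right x ⊕ right y)
      ≈⟨ +-cong (*-congˡ (dot-axpyʳ a (right x) (right y) (left x))) (dot-axpyʳ a (right x) (right y) (left y)) ⟩
    a ∙ (a ∙ dot (left x) (right x) + dot (left x) (right y)) + (a ∙ dot (left y) (right x) + dot (left y) (right y))
      ≈⟨ solve 5 (λ a p q r s → a :* (a :* p :+ q) :+ (a :* r :+ s) := a :* a :* p :+ a :* (q :+ r) :+ s) refl a _ _ _ _ ⟩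
    a ∙ a ∙ dot (left x) (right x) + a ∙ (dot (left x) (right y) + dot (left y) (right x)) + dot (left y) (right y) ∎

  module hyperbolic {r : ℕ} = Quadratic (hyperbolic r)

  hyperbolic-nondegenerate : ∀ {r} (x : H r) → (∀ y → hyperbolic.bil x y ≈ 0#) → x ≋ 𝟎
  hyperbolic-nondegenerate x ⊥x (inj₁ i) = dot-nondegenerate (left x) (λ u → begin
    dot u (left x)                                ≈⟨ dot-comm u _ ⟩
    dot (left x) u                                ≈⟨ +-identityʳ _ ⟨
    dot (left x) u + 0#                           ≈⟨ +-congˡ (dot-𝟎ˡ (right x)) ⟨
    dot (left x) u + dot 𝟎 (right x)              ≈⟨ ⊥x [ 𝟎 , u ] ⟩
    0#                                            ∎) i
  hyperbolic-nondegenerate x ⊥x (inj₂ i) = dot-nondegenerate (right x) (λ u → begin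
    dot u (right x)                               ≈⟨ +-identityˡ _ ⟨
    0# + dot u (right x)                          ≈⟨ +-congʳ (dot-𝟎ʳ (left x)) ⟨
    dot (left x) 𝟎 + dot u (right x)              ≈⟨ ⊥x [ u , 𝟎 ] ⟩
    0#                                            ∎) i

  -- A vector of the kernel is orthogonal to all of `H r`, because the polar form is preserved, and
  -- `H r` is nondegenerate.
  isometry-injective : ∀ {r} {J : Set} {Q : Quadratic J} (f : Isometry (hyperbolic r) Q) →
                       ∀ {x y} → Isometry.fun f x ≋ Isometry.fun f y → x ≋ y
  isometry-injective {Q = Q} f = trivialKernel⇒injective λ x fx≋𝟎 → hyperbolic-nondegenerate x λ y → begin
    hyperbolic.bil x y      ≈⟨ bil-preserving x y ⟨
    Q.bil (fun x) (fun y)   ≈⟨ Q.bil-cong fx≋𝟎 ≋.refl ⟩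
    Q.bil 𝟎 (fun y)         ≈⟨ Q.bil-sym _ _ ⟩
    Q.bil (fun y) 𝟎         ≈⟨ Q.bil-𝟎ʳ _ ⟩
    0#                      ∎
    where
    module Q = Quadratic Q
    open Isometry f

  cardinality-H : ∀ r → HasCardinality (functions (Fin r ⊎ Fin r)) (q ^ r ℕ.* q ^ r)
  cardinality-H r = double (vectors r) (vectors r)

  isometry-surjective : ∀ {r} (f : Isometry (hyperbolic r) (hyperbolic r)) →
                        ∀ y → ∃[ x ] Isometry.fun f x ≋ y
  isometry-surjective {r} f = injective⇒surjective (cardinality-H r) (cardinality-H r)
    (Isometry.fun f) (Isometry.cong f) (isometry-injective f)

  -- Embedding hyperbolic spaces

  extend : ∀ {r} → Carrier → Carrier → H r → H (ℕ.suc r)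
  extend a b x = [ a ∷ left x , b ∷ right x ]

  rest : ∀ {r} → H (ℕ.suc r) → H r
  rest x = [ tail (left x) , tail (right x) ]

  extend-cong : ∀ {r} {a a′ b b′} {x x′ : H r} → a ≈ a′ → b ≈ b′ → x ≋ x′ → extend a b x ≋ extend a′ b′ x′
  extend-cong a≈ b≈ x≋ (inj₁ i) = ∷-cong a≈ (x≋ ∘ inj₁) i
  extend-cong a≈ b≈ x≋ (inj₂ i) = ∷-cong b≈ (x≋ ∘ inj₂) i

  extend-scalars : ∀ {r} (x : H r) {a a′ b b′} → a ≈ a′ → b ≈ b′ → extend a b x ≋ extend a′ b′ x
  extend-scalars x a≈ b≈ = extend-cong {x = x} a≈ b≈ ≋.refl

  extend-axpy : ∀ {r} a s t s′ t′ (x y : H r) →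
                extend (a ∙ s + s′) (a ∙ t + t′) (a · x ⊕ y) ≋ a · extend s t x ⊕ extend s′ t′ y
  extend-axpy a s t s′ t′ x y (inj₁ i) = ∷-axpy a s s′ (left x) (left y) i
  extend-axpy a s t s′ t′ x y (inj₂ i) = ∷-axpy a t t′ (right x) (right y) i

  extend-η : ∀ {r} (x : H (ℕ.suc r)) → extend (left x zero) (right x zero) (rest x) ≋ x
  extend-η x (inj₁ i) = ∷-η (left x) i
  extend-η x (inj₂ i) = ∷-η (right x) i

  pair-cong : ∀ {r} {l l′ k k′ : V r} → l ≋ l′ → k ≋ k′ → _≋_ {Fin r ⊎ Fin r} [ l , k ] [ l′ , k′ ]
  pair-cong l≋ k≋ (inj₁ i) = l≋ i
  pair-cong l≋ k≋ (inj₂ i) = k≋ i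

  rest-cong : ∀ {r} {x y : H (ℕ.suc r)} → x ≋ y → rest x ≋ rest y
  rest-cong x≋y = pair-cong (x≋y ∘ inj₁ ∘ suc) (x≋y ∘ inj₂ ∘ suc)

  rest-axpy : ∀ {r} a (x y : H (ℕ.suc r)) → rest (a · x ⊕ y) ≋ a · rest x ⊕ rest y
  rest-axpy a x y (inj₁ i) = refl
  rest-axpy a x y (inj₂ i) = refl

  0∷-linear : ∀ {r} → IsLinear {Fin r} {Fin (ℕ.suc r)} (0# ∷_)
  0∷-linear = record
    { cong = ∷-cong refl
    ; axpy = λ a x y → ≋.trans
        (∷-cong {u = a · x ⊕ y} (solve 1 (λ a → con (+ 0) := a :* con (+ 0) :+ con (+ 0)) refl a) ≋.refl) (∷-axpy a 0# 0# x y)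
    }

  module Ambient {J : Set} (Q : Quadratic J) where

    open Quadratic Q

    singular⇒orthogonal : ∀ {x y} → form x ≈ 0# → form y ≈ 0# → form (x ⊕ y) ≈ 0# → bil x y ≈ 0#
    singular⇒orthogonal {x} {y} fx fy fxy = begin
      bil x y
        ≈⟨ solve 1 (λ b → b := con (+ 0) :+ b :+ con (+ 0)) refl (bil x y) ⟩
      0# + bil x y + 0#
        ≈⟨ +-cong (+-congʳ fx) fy ⟨
      form x + bil x y + form y
        ≈⟨ form-⊕ x y ⟨
      form (x ⊕ y)
        ≈⟨ fxy ⟩
      0# ∎

    -- A linear functional on a hyperbolic space is the pairing with a vector. When θ is an
    -- isometry, `θ h` is the orthogonal projection of v onto the image of θ, which is how the lemma
    -- gets used.
    represent : ∀ {r} (θ : H r → Fun J) → IsLinear θ → ∀ v →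
                ∃[ h ] ∀ x → bil v (θ x) ≈ hyperbolic.bil h x
    represent {ℕ.zero} θ lin v = 𝟎 , λ x → begin
      bil v (θ x)   ≈⟨ bil-cong ≋.refl (cong {x} {𝟎} λ { (inj₁ ()) ; (inj₂ ()) }) ⟩
      bil v (θ 𝟎)   ≈⟨ bil-cong ≋.refl 𝟎-homo ⟩
      bil v 𝟎       ≈⟨ bil-𝟎ʳ v ⟩
      0#            ≈⟨ +-identityˡ 0# ⟨
      0# + 0#       ∎
      where open IsLinear lin
    represent {ℕ.suc r} θ lin v
      with represent (θ ∘ extend 0# 0#) (record
             { cong = cong ∘ extend-cong refl refl
             ; axpy = λ a x y → ≋.trans (cong (≋.trans (extend-cong {x = a · x ⊕ y} (a0+0 a) (a0+0 a) ≋.refl) (extend-axpy a 0# 0# 0# 0# x y)))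
                                        (axpy a _ _)
             }) v
      where
      open IsLinear lin
      a0+0 : ∀ a → 0# ≈ a ∙ 0# + 0#
      a0+0 a = solve 1 (λ a → con (+ 0) := a :* con (+ 0) :+ con (+ 0)) refl a
    -- Since e and f are dual to each other, the value at f is the coordinate of h along e, and vice
    -- versa.
    ... | h , rep = extend (bil v (θ f)) (bil v (θ e)) h , λ x → begin
      bil v (θ x)
        ≈⟨ bil-cong ≋.refl (cong (decompose x)) ⟩
      bil v (θ (left x zero · e ⊕ (right x zero · f ⊕ extend 0# 0# (rest x))))
        ≈⟨ bil-cong ≋.refl (≋.trans (axpy _ _ _) (⊕-cong ≋.refl (axpy _ _ _))) ⟩
      bil v (left x zero · θ e ⊕ (right x zero · θ f ⊕ θ (extend 0# 0# (rest x))))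
        ≈⟨ trans (bil-axpyʳ _ _ _ v) (+-congˡ (bil-axpyʳ _ _ _ v)) ⟩
      left x zero ∙ bil v (θ e) + (right x zero ∙ bil v (θ f) + bil v (θ (extend 0# 0# (rest x))))
        ≈⟨ +-congˡ (+-congˡ (rep (rest x))) ⟩
      left x zero ∙ bil v (θ e) + (right x zero ∙ bil v (θ f) + hyperbolic.bil h (rest x))
        ≈⟨ solve 6 (λ l k be bf p q → l :* be :+ (k :* bf :+ (p :+ q)) := (bf :* k :+ p) :+ (l :* be :+ q)) refl
             (left x zero) (right x zero) (bil v (θ e)) (bil v (θ f)) _ _ ⟩
      hyperbolic.bil (extend (bil v (θ f)) (bil v (θ e)) h) x ∎
      where
      open IsLinear lin
      e f : H (ℕ.suc r)
      e = extend 1# 0# 𝟎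
      f = extend 0# 1# 𝟎
      on₁ : ∀ l k → l ≈ l ∙ 1# + (k ∙ 0# + 0#)
      on₁ l k = solve 2 (λ l k → l := l :* con (+ 1) :+ (k :* con (+ 0) :+ con (+ 0))) refl l k
      on₂ : ∀ l k → k ≈ l ∙ 0# + (k ∙ 1# + 0#)
      on₂ l k = solve 2 (λ l k → k := l :* con (+ 0) :+ (k :* con (+ 1) :+ con (+ 0))) refl l k
      off : ∀ l k x → x ≈ l ∙ 0# + (k ∙ 0# + x)
      off l k x = solve 3 (λ l k x → x := l :* con (+ 0) :+ (k :* con (+ 0) :+ x)) refl l k x
      decompose : ∀ x → x ≋ left x zero · e ⊕ (right x zero · f ⊕ extend 0# 0# (rest x))
      decompose x (inj₁ zero)    = on₁ _ _
      decompose x (inj₁ (suc i)) = off _ _ _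
      decompose x (inj₂ zero)    = on₂ _ _
      decompose x (inj₂ (suc i)) = off _ _ _

    extend-isometry : ∀ {r} (θ : Isometry (hyperbolic r) Q) (e f : Fun J) →
      form e ≈ 0# → form f ≈ 0# → bil e f ≈ 1# →
      (∀ x → bil e (Isometry.fun θ x) ≈ 0#) → (∀ x → bil f (Isometry.fun θ x) ≈ 0#) →
      Isometry (hyperbolic (ℕ.suc r)) Q
    extend-isometry θ e f e-sing f-sing ef≈1 e⊥ f⊥ = record
      { fun       = λ x → left x zero · e ⊕ (right x zero · f ⊕ fun (rest x))
      ; isLinear  = record
        { cong = λ x≋y → ⊕-cong (·-cong (x≋y _) ≋.refl) (⊕-cong (·-cong (x≋y _) ≋.refl) (cong (rest-cong x≋y)))
        ; axpy = λ a x y i → begin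
            (a ∙ left x zero + left y zero) ∙ e i + ((a ∙ right x zero + right y zero) ∙ f i + fun (rest (a · x ⊕ y)) i)
              ≈⟨ +-congˡ (+-congˡ (cong (rest-axpy a x y) i)) ⟩
            (a ∙ left x zero + left y zero) ∙ e i + ((a ∙ right x zero + right y zero) ∙ f i + fun (a · rest x ⊕ rest y) i)
              ≈⟨ +-congˡ (+-congˡ (axpy a (rest x) (rest y) i)) ⟩
            (a ∙ left x zero + left y zero) ∙ e i + ((a ∙ right x zero + right y zero) ∙ f i + (a ∙ fun (rest x) i + fun (rest y) i))
              ≈⟨ solve 9 (λ a l l′ k k′ e f s t → (a :* l :+ l′) :* e :+ ((a :* k :+ k′) :* f :+ (a :* s :+ t))
                           := a :* (l :* e :+ (k :* f :+ s)) :+ (l′ :* e :+ (k′ :* f :+ t))) refl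
                   a (left x zero) (left y zero) (right x zero) (right y zero) (e i) (f i) (fun (rest x) i) (fun (rest y) i) ⟩
            a ∙ (left x zero ∙ e i + (right x zero ∙ f i + fun (rest x) i)) + (left y zero ∙ e i + (right y zero ∙ f i + fun (rest y) i)) ∎
        }
      ; isometric = λ x → begin
          form (left x zero · e ⊕ (right x zero · f ⊕ fun (rest x)))
            ≈⟨ form-axpy _ _ _ ⟩
          left x zero ∙ left x zero ∙ form e + left x zero ∙ bil e (right x zero · f ⊕ fun (rest x)) + form (right x zero · f ⊕ fun (rest x))
            ≈⟨ +-cong (+-cong (*-congˡ e-sing) (*-congˡ (bil-axpyʳ _ _ _ e))) (form-axpy _ _ _) ⟩
          left x zero ∙ left x zero ∙ 0# + left x zero ∙ (right x zero ∙ bil e f + bil e (fun (rest x)))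
            + (right x zero ∙ right x zero ∙ form f + right x zero ∙ bil f (fun (rest x)) + form (fun (rest x)))
            ≈⟨ +-cong (+-congˡ (*-congˡ (+-cong (*-congˡ ef≈1) (e⊥ _))))
                      (+-cong (+-cong (*-congˡ f-sing) (*-congˡ (f⊥ _))) (isometric _)) ⟩
          left x zero ∙ left x zero ∙ 0# + left x zero ∙ (right x zero ∙ 1# + 0#)
            + (right x zero ∙ right x zero ∙ 0# + right x zero ∙ 0# + hyperbolic.form (rest x))
            ≈⟨ solve 3 (λ l k t → l :* l :* con (+ 0) :+ l :* (k :* con (+ 1) :+ con (+ 0))
                          :+ (k :* k :* con (+ 0) :+ k :* con (+ 0) :+ t) := l :* k :+ t) refl (left x zero) (right x zero) _ ⟩
          left x zero ∙ right x zero + hyperbolic.form (rest x) ∎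
      }
      where open Isometry θ

  module Witt {d : ℕ} (Q : Quadratic (Fin d))
    (nondegenerate : ∀ v → Quadratic.form Q v ≈ 0# → (∀ w → Quadratic.bil Q v w ≈ 0#) → v ≋ 𝟎) where

    open Quadratic Q
    open Ambient Q

    witness : ∀ {v} → form v ≈ 0# → ¬ v ≋ 𝟎 → ∃[ w ] bil v w ≈ 1#
    witness {v} v-sing v≠𝟎 with Finite.exists? (functions (Fin d)) (vectors d) {P = λ w → ¬ bil v w ≈ 0#}
        (λ w≋w′ ¬⊥ ⊥′ → ¬⊥ (trans (bil-cong ≋.refl w≋w′) ⊥′)) (λ w → ¬? (bil v w ≟ 0#))
    ... | no  none = contradiction (nondegenerate v v-sing λ w → decidable-stable (bil v w ≟ 0#) (λ ¬⊥ → none (w , ¬⊥))) v≠𝟎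
    ... | yes (w , ¬⊥) with inverse ¬⊥
    ... | c , c∙≈1 = c · w , trans (bil-·ʳ c w v) c∙≈1

    -- Hyperbolic pairs are added one at a time to complete a totally singular space. The second
    -- component is the induction invariant: the left half of `H k` stays inside the image of ι, so
    -- the next vector can be made orthogonal to the earlier pairs without leaving that image.
    embed : ∀ {k} (ι : V k → V d) → IsLinear ι → (∀ a → ι a ≋ 𝟎 → a ≋ 𝟎) → (∀ a → form (ι a) ≈ 0#) →
            Σ (Isometry (hyperbolic k) Q) λ θ → ∀ l → ∃[ a ] Isometry.fun θ [ l , 𝟎 ] ≋ ι a
    embed {ℕ.zero} ι lin inj sing = record
      { fun       = λ _ → 𝟎
      ; isLinear  = record { cong = λ _ → ≋.refl ; axpy = λ a _ _ _ → solve 1 (λ a → con (+ 0) := a :* con (+ 0) :+ con (+ 0)) refl a }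
      ; isometric = λ _ → form-𝟎
      } , λ l → 𝟎 , ≋.sym (IsLinear.𝟎-homo lin)
    embed {ℕ.suc k} ι lin inj sing with embed (ι ∘ (0# ∷_)) (∘-isLinear lin 0∷-linear) ι₀-kernel (λ a → sing _)
      where
      open IsLinear lin
      ι₀-kernel : ∀ a → ι (0# ∷ a) ≋ 𝟎 → a ≋ 𝟎
      ι₀-kernel a ιa≋𝟎 = inj (0# ∷ a) ιa≋𝟎 ∘ suc
    ... | θ , track = extend-isometry θ e f e-sing f-sing ef≈1 e⊥ f⊥ , λ l → l zero · (1# ∷ - 1# · a₀) ⊕ (0# ∷ proj₁ (track (tail l))) , track⁺ l
      where
      open IsLinear lin
      open Isometry θ using (fun; bil-preserving) renaming (cong to fun-cong)
      u : V d
      u = ι (1# ∷ 𝟎)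
      h : H k
      h = proj₁ (represent fun (Isometry.isLinear θ) u)
      h-rep : ∀ x → bil u (fun x) ≈ hyperbolic.bil h x
      h-rep = proj₂ (represent fun (Isometry.isLinear θ) u)
      -- Both u and the tracked left half lie in the totally singular image of ι and are therefore
      -- orthogonal, so the projection of u has no right half.
      right-h : right h ≋ 𝟎
      right-h = dot-nondegenerate (right h) λ l → begin
        dot l (right h)                     ≈⟨ +-identityˡ _ ⟨
        0# + dot l (right h)                ≈⟨ +-congʳ (dot-𝟎ʳ (left h)) ⟨
        hyperbolic.bil h [ l , 𝟎 ]          ≈⟨ h-rep [ l , 𝟎 ] ⟨
        bil u (fun [ l , 𝟎 ])               ≈⟨ bil-cong ≋.refl (proj₂ (track l)) ⟩
        bil u (ι (0# ∷ proj₁ (track l)))    ≈⟨ singular⇒orthogonal (sing _) (sing _)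
                                                 (trans (form-cong (≋.sym (⊕-homo _ _))) (sing _)) ⟩
        0#                                  ∎
      a₀ : V k
      a₀ = proj₁ (track (left h))
      θh : fun h ≋ ι (0# ∷ a₀)
      θh = ≋.trans (fun-cong λ { (inj₁ i) → refl ; (inj₂ i) → right-h i }) (proj₂ (track (left h)))
      -- This is u minus its projection. That projection comes from the left half, so e is again in
      -- the image of ι: singular, and nonzero because its first parameter is 1.
      e : V d
      e = ι (1# ∷ - 1# · a₀)
      e-expand : e ≋ - 1# · fun h ⊕ u
      e-expand = ≋.trans (cong λ
        { zero    → solve 0 (con (+ 1) := :- con (+ 1) :* con (+ 0) :+ con (+ 1)) refl
        ; (suc i) → sym (+-identityʳ _) }) (≋.trans (axpy (- 1#) (0# ∷ a₀) (1# ∷ 𝟎)) (⊕-cong (·-cong refl (≋.sym θh)) ≋.refl))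
      e-sing : form e ≈ 0#
      e-sing = sing _
      e≠𝟎 : ¬ e ≋ 𝟎
      e≠𝟎 e≋𝟎 = 1≉0 (inj _ e≋𝟎 zero)
      cancel : ∀ b → - 1# ∙ b + b ≈ 0#
      cancel b = solve 1 (λ b → :- con (+ 1) :* b :+ b := con (+ 0)) refl b
      e⊥ : ∀ x → bil e (fun x) ≈ 0#
      e⊥ x = begin
        bil e (fun x)                                     ≈⟨ bil-cong e-expand ≋.refl ⟩
        bil (- 1# · fun h ⊕ u) (fun x)                    ≈⟨ bil-axpyˡ _ _ _ _ ⟩
        - 1# ∙ bil (fun h) (fun x) + bil u (fun x)        ≈⟨ +-cong (*-congˡ (bil-preserving h x)) (h-rep x) ⟩
        - 1# ∙ hyperbolic.bil h x + hyperbolic.bil h x    ≈⟨ cancel _ ⟩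
        0#                                                ∎
      w g : V d
      w = proj₁ (witness e-sing e≠𝟎)
      m : H k
      m = proj₁ (represent fun (Isometry.isLinear θ) w)
      m-rep : ∀ x → bil w (fun x) ≈ hyperbolic.bil m x
      m-rep = proj₂ (represent fun (Isometry.isLinear θ) w)
      -- The partner w is projected away from the earlier pairs as well; its pairing with e stays 1
      -- because e is orthogonal to them.
      g = - 1# · fun m ⊕ w
      eg≈1 : bil e g ≈ 1#
      eg≈1 = begin
        bil e g                                ≈⟨ bil-axpyʳ _ _ _ _ ⟩
        - 1# ∙ bil e (fun m) + bil e w         ≈⟨ +-cong (*-congˡ (e⊥ m)) (proj₂ (witness e-sing e≠𝟎)) ⟩
        - 1# ∙ 0# + 1#                         ≈⟨ solve 0 (:- con (+ 1) :* con (+ 0) :+ con (+ 1) := con (+ 1)) refl ⟩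
        1#                                     ∎
      g⊥ : ∀ x → bil g (fun x) ≈ 0#
      g⊥ x = begin
        bil g (fun x)                                     ≈⟨ bil-axpyˡ _ _ _ _ ⟩
        - 1# ∙ bil (fun m) (fun x) + bil w (fun x)        ≈⟨ +-cong (*-congˡ (bil-preserving m x)) (m-rep x) ⟩
        - 1# ∙ hyperbolic.bil m x + hyperbolic.bil m x    ≈⟨ cancel _ ⟩
        0#                                                ∎
      -- As e is singular and pairs to 1 with g, subtracting `form g` times e makes g singular
      -- without a division by 2.
      f : V d
      f = - form g · e ⊕ g
      f-sing : form f ≈ 0#
      f-sing = begin
        form f
          ≈⟨ form-axpy _ _ _ ⟩
        - form g ∙ - form g ∙ form e + - form g ∙ bil e g + form g
          ≈⟨ +-congʳ (+-cong (*-congˡ e-sing) (*-congˡ eg≈1)) ⟩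
        - form g ∙ - form g ∙ 0# + - form g ∙ 1# + form g
          ≈⟨ solve 1 (λ s → :- s :* :- s :* con (+ 0) :+ :- s :* con (+ 1) :+ s := con (+ 0)) refl (form g) ⟩
        0# ∎
      ef≈1 : bil e f ≈ 1#
      ef≈1 = begin
        bil e f
          ≈⟨ bil-axpyʳ _ _ _ _ ⟩
        - form g ∙ bil e e + bil e g
          ≈⟨ +-cong (*-congˡ (trans (bil-self e) (+-cong e-sing e-sing))) eg≈1 ⟩
        - form g ∙ (0# + 0#) + 1#
          ≈⟨ solve 1 (λ s → :- s :* (con (+ 0) :+ con (+ 0)) :+ con (+ 1) := con (+ 1)) refl (form g) ⟩
        1# ∎
      f⊥ : ∀ x → bil f (fun x) ≈ 0#
      f⊥ x = begin
        bil f (fun x)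
          ≈⟨ bil-axpyˡ _ _ _ _ ⟩
        - form g ∙ bil e (fun x) + bil g (fun x)
          ≈⟨ +-cong (*-congˡ (e⊥ x)) (g⊥ x) ⟩
        - form g ∙ 0# + 0#
          ≈⟨ solve 1 (λ s → :- s :* con (+ 0) :+ con (+ 0) := con (+ 0)) refl (form g) ⟩
        0# ∎
      track⁺ : ∀ l → l zero · e ⊕ (0# · f ⊕ fun (rest [ l , 𝟎 ])) ≋ ι (l zero · (1# ∷ - 1# · a₀) ⊕ (0# ∷ proj₁ (track (tail l))))
      track⁺ l i = begin
        l zero ∙ e i + (0# ∙ f i + fun (rest [ l , 𝟎 ]) i)
          ≈⟨ +-congˡ (+-cong (zeroˡ _) (fun-cong (λ { (inj₁ j) → refl ; (inj₂ j) → refl }) i)) ⟩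
        l zero ∙ e i + (0# + fun [ tail l , 𝟎 ] i)
          ≈⟨ +-congˡ (trans (+-identityˡ _) (proj₂ (track (tail l)) i)) ⟩
        l zero ∙ e i + ι (0# ∷ proj₁ (track (tail l))) i
          ≈⟨ axpy _ _ _ i ⟨
        ι (l zero · (1# ∷ - 1# · a₀) ⊕ (0# ∷ proj₁ (track (tail l)))) i ∎

    embedding : ∀ {k} (ι : V k → V d) → IsLinear ι → (∀ a → ι a ≋ 𝟎 → a ≋ 𝟎) → (∀ a → form (ι a) ≈ 0#) →
                Isometry (hyperbolic k) Q
    embedding ι lin inj sing = proj₁ (embed ι lin inj sing)

  -- Classification of generators

  bil-extend : ∀ {r} s t s′ t′ (x y : H r) →
               hyperbolic.bil (extend s t x) (extend s′ t′ y) ≈ s ∙ t′ + s′ ∙ t + hyperbolic.bil x y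
  bil-extend s t s′ t′ x y = solve 4 (λ a b c d → (a :+ b) :+ (c :+ d) := a :+ c :+ (b :+ d)) refl _ _ _ _

  identity : ∀ {I : Set} (Q : Quadratic I) → Isometry Q Q
  identity Q = record
    { fun       = id
    ; isLinear  = record { cong = id ; axpy = λ _ _ _ → ≋.refl }
    ; isometric = λ _ → refl
    }

  lift : ∀ {r} → Isometry (hyperbolic r) (hyperbolic r) → Isometry (hyperbolic (ℕ.suc r)) (hyperbolic (ℕ.suc r))
  lift g = record
    { fun       = λ x → extend (left x zero) (right x zero) (fun (rest x))
    ; isLinear  = record
      { cong = λ x≋y → extend-cong (x≋y _) (x≋y _) (cong (rest-cong x≋y))
      ; axpy = λ a x y → ≋.trans (extend-cong refl refl (≋.trans (cong (rest-axpy a x y)) (axpy a (rest x) (rest y))))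
                                 (extend-axpy a _ _ _ _ (fun (rest x)) (fun (rest y)))
      }
    ; isometric = λ x → +-congˡ (isometric (rest x))
    }
    where open Isometry g

  -- Swaps the first hyperbolic pair and twists by the functional `dot _ λ′`. The generator with
  -- zero right half goes to one that misses `extend 1# 0# 𝟎`; the sign of `λ′` cancels the cross
  -- term in the form.
  shear : ∀ {r} → V r → Isometry (hyperbolic (ℕ.suc r)) (hyperbolic (ℕ.suc r))
  shear {r} λ′ = record
    { fun       = λ x → extend (right x zero + dot (tail (left x)) λ′) (left x zero)
                               [ tail (left x) , - left x zero · λ′ ⊕ tail (right x) ]
    ; isLinear  = record
      { cong = λ x≋y → extend-cong (+-cong (x≋y _) (dot-cong (x≋y ∘ inj₁ ∘ suc) ≋.refl)) (x≋y _)
                         (pair-cong (x≋y ∘ inj₁ ∘ suc) (⊕-cong (·-cong (-‿cong (x≋y _)) ≋.refl) (x≋y ∘ inj₂ ∘ suc)))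
      ; axpy = λ a x y → λ
        { (inj₁ zero)    → trans (+-congˡ (dot-axpyˡ a (tail (left x)) (tail (left y)) λ′))
            (solve 5 (λ a k k′ d d′ → (a :* k :+ k′) :+ (a :* d :+ d′) := a :* (k :+ d) :+ (k′ :+ d′)) refl a _ _ _ _)
        ; (inj₁ (suc i)) → refl
        ; (inj₂ zero)    → refl
        ; (inj₂ (suc i)) → solve 6 (λ a l l′ m k k′ → :- (a :* l :+ l′) :* m :+ (a :* k :+ k′) := a :* (:- l :* m :+ k) :+ (:- l′ :* m :+ k′))
                             refl a (left x zero) (left y zero) (λ′ i) _ _
        }
      }
    ; isometric = λ x → trans (+-congˡ (dot-axpyʳ (- left x zero) λ′ (tail (right x)) (tail (left x))))
        (solve 4 (λ k d l e → (k :+ d) :* l :+ (:- l :* d :+ e) := l :* k :+ e) refl (right x zero) _ (left x zero) _)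
    }

  -- One choice per hyperbolic pair: `zero` when the generator contains e, and `suc i` when it
  -- misses e and is given by the functional `vector i`.
  Code : ℕ → Set
  Code ℕ.zero    = ⊤
  Code (ℕ.suc r) = Code r × Fin (ℕ.suc (q ^ r))

  codeCount : ℕ → ℕ
  codeCount ℕ.zero    = 1
  codeCount (ℕ.suc r) = codeCount r ℕ.* ℕ.suc (q ^ r)

  codes : ∀ r → HasCardinality (≡.setoid (Code r)) (codeCount r)
  codes ℕ.zero    = ↔-sym Fin.1↔⊤
  codes (ℕ.suc r) = ↔-trans (codes r ×-↔ ↔-refl) (↔-sym Fin.*↔×)

  vector : ∀ {r} → Fin (q ^ r) → V r
  vector {r} = Inverse.from (vectors r)

  vector-injective : ∀ {r} {i j : Fin (q ^ r)} → vector {r} i ≋ vector {r} j → i ≡ j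
  vector-injective {r} eq = ≡.trans (≡.sym (strictlyInverseˡ _)) (≡.trans (to-cong eq) (strictlyInverseˡ _))
    where open Inverse (vectors r)

  -- frame γ maps the generator { x ∣ right x ≋ 𝟎 } to the generator with code γ.
  frame : ∀ {r} → Code r → Isometry (hyperbolic r) (hyperbolic r)
  frame {ℕ.zero}  _           = identity _
  frame {ℕ.suc r} (γ , zero)  = lift (frame γ)
  frame {ℕ.suc r} (γ , suc i) = lift (frame γ) ∘ᵢ shear (vector i)

  module frame {r : ℕ} (γ : Code r) = Isometry (frame γ)

  element : ∀ {r} → Code r → V r → H r
  element γ a = frame.fun γ [ a , 𝟎 ]

  element-zero : ∀ {r} (γ : Code r) a → element (γ , zero) a ≋ extend (a zero) 0# (element γ (tail a))
  element-zero γ a = extend-cong refl refl (frame.cong γ λ { (inj₁ i) → refl ; (inj₂ i) → refl })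

  element-suc : ∀ {r} (γ : Code r) i a →
                element (γ , suc i) a ≋ extend (dot (tail a) (vector i)) (a zero) (frame.fun γ [ tail a , - a zero · vector i ])
  element-suc γ i a = extend-cong (+-identityˡ _) refl (frame.cong γ λ { (inj₁ j) → refl ; (inj₂ j) → +-identityʳ _ })

  -- Pulled back along `frame γ`, the hypothesis says that the right half of the preimage pairs to
  -- zero with every a, so that half vanishes.
  element-maximal : ∀ {r} (γ : Code r) x → (∀ a → hyperbolic.bil x (element γ a) ≈ 0#) → ∃[ a ] element γ a ≋ x
  element-maximal {r} γ x x⊥ = left y , ≋.trans (frame.cong γ (≋.sym y≋)) y↦x
    where
    y : H r
    y = proj₁ (isometry-surjective (frame γ) x)
    y↦x : frame.fun γ y ≋ x
    y↦x = proj₂ (isometry-surjective (frame γ) x)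
    y≋ : y ≋ [ left y , 𝟎 ]
    y≋ (inj₁ i) = refl
    y≋ (inj₂ i) = dot-nondegenerate (right y) (λ a → begin
      dot a (right y)                                        ≈⟨ +-identityˡ _ ⟨
      0# + dot a (right y)                                   ≈⟨ +-congʳ (dot-𝟎ʳ (left y)) ⟨
      hyperbolic.bil y [ a , 𝟎 ]                             ≈⟨ frame.bil-preserving γ y [ a , 𝟎 ] ⟨
      hyperbolic.bil (frame.fun γ y) (element γ a)           ≈⟨ hyperbolic.bil-cong {y = element γ a} y↦x ≋.refl ⟩
      hyperbolic.bil x (element γ a)                         ≈⟨ x⊥ a ⟩
      0#                                                     ∎) i

  -- The vector with parameter `1# ∷ 𝟎` displays the functional in its right half, and comparing
  -- second scalars forces `b zero` to be 1.
  element-suc-injective : ∀ {r} (γ : Code r) i j →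
                          (∀ a → ∃[ b ] element (γ , suc i) a ≋ element (γ , suc j) b) → i ≡ j
  element-suc-injective {r} γ i j sub = vector-injective {r} vᵢ≋vⱼ
    where
    b = proj₁ (sub (1# ∷ 𝟎))
    eq′ = ≋.trans (≋.sym (element-suc γ i (1# ∷ 𝟎))) (≋.trans (proj₂ (sub (1# ∷ 𝟎))) (element-suc γ j b))
    vᵢ≋vⱼ : vector i ≋ vector j
    vᵢ≋vⱼ k = begin
      vector i k                 ≈⟨ solve 1 (λ v → v := :- (:- con (+ 1) :* v)) refl _ ⟩
      - (- 1# ∙ vector i k)      ≈⟨ -‿cong (isometry-injective (frame γ)
                                      {[ 𝟎 , - 1# · vector i ]} {[ tail b , - b zero · vector j ]}
                                      (λ { (inj₁ k) → eq′ (inj₁ (suc k)) ; (inj₂ k) → eq′ (inj₂ (suc k)) }) (inj₂ k)) ⟩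
      - (- b zero ∙ vector j k)  ≈⟨ -‿cong (*-congʳ (-‿cong (eq′ (inj₂ zero)))) ⟨
      - (- 1# ∙ vector j k)      ≈⟨ solve 1 (λ v → v := :- (:- con (+ 1) :* v)) refl _ ⟨
      vector j k                 ∎

  -- A one-sided inclusion suffices. Mixed kinds are impossible: e lies only in generators of the
  -- first kind, and only those of the second kind have a vector with second scalar 1. For two of
  -- the second kind, the parameters `0# ∷ a` compare the projections, after which the functionals
  -- can be compared.
  element-injective : ∀ {r} (γ δ : Code r) → (∀ a → ∃[ b ] element γ a ≋ element δ b) → γ ≡ δ
  element-injective {ℕ.zero}  γ δ sub = ≡.refl
  element-injective {ℕ.suc r} (γ , zero) (δ , zero) sub = ≡.cong (_, zero) (element-injective γ δ λ a →
    let b , eq = sub (0# ∷ a)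
        eq′ = ≋.trans (≋.sym (element-zero γ (0# ∷ a))) (≋.trans eq (element-zero δ b))
    in tail b , ≋.trans (λ { (inj₁ i) → refl ; (inj₂ i) → refl }) (≋.trans (rest-cong eq′) λ { (inj₁ i) → refl ; (inj₂ i) → refl }))
  element-injective {ℕ.suc r} (γ , zero) (δ , suc j) sub = contradiction (begin
    1#                           ≈⟨ eq′ (inj₁ zero) ⟩
    dot (tail b) (vector {r} j)  ≈⟨ dot-cong {v = vector {r} j} tail-b≋𝟎 ≋.refl ⟩
    dot 𝟎 (vector {r} j)         ≈⟨ dot-𝟎ˡ (vector {r} j) ⟩
    0#                           ∎) 1≉0
    where
    b = proj₁ (sub (1# ∷ 𝟎))
    eq′ = ≋.trans (≋.sym (element-zero γ (1# ∷ 𝟎))) (≋.trans (proj₂ (sub (1# ∷ 𝟎))) (element-suc δ j b))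
    tail-b≋𝟎 : tail b ≋ 𝟎
    tail-b≋𝟎 i = isometry-injective (frame δ) {[ tail b , - b zero · vector j ]} {𝟎}
      (≋.trans (λ { (inj₁ i) → sym (eq′ (inj₁ (suc i))) ; (inj₂ i) → sym (eq′ (inj₂ (suc i))) })
        (≋.trans (frame.cong γ λ { (inj₁ i) → refl ; (inj₂ i) → refl })
          (≋.trans (frame.𝟎-homo γ) (≋.sym (frame.𝟎-homo δ))))) (inj₁ i)
  element-injective {ℕ.suc r} (γ , suc i) (δ , zero) sub = contradiction (eq′ (inj₂ zero)) 1≉0
    where
    b = proj₁ (sub (1# ∷ 𝟎))
    eq′ = ≋.trans (≋.sym (element-suc γ i (1# ∷ 𝟎))) (≋.trans (proj₂ (sub (1# ∷ 𝟎))) (element-zero δ b))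
  element-injective {ℕ.suc r} (γ , suc i) (δ , suc j) sub = step (element-injective γ δ γ⊆δ)
    where
    γ⊆δ : ∀ a → ∃[ b ] element γ a ≋ element δ b
    γ⊆δ a = tail b , ≋.trans (frame.cong γ λ { (inj₁ k) → refl ; (inj₂ k) → solve 1 (λ v → con (+ 0) := :- con (+ 0) :* v) refl _ })
      (≋.trans (λ { (inj₁ k) → eq′ (inj₁ (suc k)) ; (inj₂ k) → eq′ (inj₂ (suc k)) })
        (frame.cong δ λ { (inj₁ k) → refl ; (inj₂ k) → trans (*-congʳ (-‿cong (sym (eq′ (inj₂ zero)))))
                                                            (solve 1 (λ v → :- con (+ 0) :* v := con (+ 0)) refl _) }))
      where
      b = proj₁ (sub (0# ∷ a))
      eq′ = ≋.trans (≋.sym (element-suc γ i (0# ∷ a))) (≋.trans (proj₂ (sub (0# ∷ a))) (element-suc δ j b))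
    step : γ ≡ δ → (γ , suc i) ≡ (δ , suc j)
    step ≡.refl = ≡.cong (λ k → γ , suc k) (element-suc-injective γ i j sub)

  -- A generator of `H r` described by membership, with maximality in place of a dimension. This
  -- form passes to the projection along e without choosing a basis.
  record MaximalSingular (r : ℕ) : Set (c ⊔ ℓ₁) where
    field
      contains    : H r → Bool
      respects    : ∀ {x y} → x ≋ y → T (contains x) → T (contains y)
      axpy-closed : ∀ a {x y} → T (contains x) → T (contains y) → T (contains (a · x ⊕ y))
      singular    : ∀ {x} → T (contains x) → hyperbolic.form x ≈ 0#
      maximal     : ∀ x → hyperbolic.form x ≈ 0# →
                    (∀ y → T (contains y) → hyperbolic.bil x y ≈ 0#) → T (contains x)

    orthogonal : ∀ x y → T (contains x) → T (contains y) → hyperbolic.bil x y ≈ 0#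
    orthogonal x y x∈ y∈ = singular⇒orthogonal {x} {y} (singular x∈) (singular y∈)
      (trans (hyperbolic.form-cong {r} {x ⊕ y} {1# · x ⊕ y} λ i → +-congʳ (sym (*-identityˡ (x i)))) (singular (axpy-closed 1# x∈ y∈)))
      where open Ambient (hyperbolic r)

    -- Written as (a - 1) x + x, so that `axpy-closed` applies.
    ·-closed : ∀ a {x} → T (contains x) → T (contains (a · x))
    ·-closed a {x} x∈ = respects (λ i → solve 2 (λ a x → (a :+ :- con (+ 1)) :* x :+ x := a :* x) refl a (x i))
                                 (axpy-closed (a - 1#) x∈ x∈)

  module Descend {r : ℕ} (U : MaximalSingular (ℕ.suc r)) where

    module U = MaximalSingular U

    e : H (ℕ.suc r)
    e = extend 1# 0# 𝟎

    Pivot : Set c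
    Pivot = T (U.contains e) ⊎ (∃[ s ] ∃[ w ] T (U.contains (extend s 1# w)))

    form-extend-0 : ∀ s (x : H r) → hyperbolic.form x ≈ 0# → hyperbolic.form (extend s 0# x) ≈ 0#
    form-extend-0 s x fx≈0 = trans (+-cong (zeroʳ _) fx≈0) (+-identityˡ 0#)

    e-bil : ∀ x → hyperbolic.bil e x ≈ right x zero
    e-bil x = begin
      1# ∙ right x zero + dot 𝟎 (tail (right x)) + (left x zero ∙ 0# + dot (tail (left x)) 𝟎)
        ≈⟨ +-cong (+-congˡ (dot-𝟎ˡ (tail (right x)))) (+-congˡ (dot-𝟎ʳ (tail (left x)))) ⟩
      1# ∙ right x zero + 0# + (left x zero ∙ 0# + 0#)
        ≈⟨ solve 2 (λ l k → con (+ 1) :* k :+ con (+ 0) :+ (l :* con (+ 0) :+ con (+ 0)) := k) refl (left x zero) (right x zero) ⟩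
      right x zero ∎

    Transversal : H (ℕ.suc r) → Set ℓ₁
    Transversal x = T (U.contains x) × ¬ right x zero ≈ 0#

    transversal? : Dec (∃ Transversal)
    transversal? = Finite.exists? (functions (Fin (ℕ.suc r) ⊎ Fin (ℕ.suc r))) (cardinality-H (ℕ.suc r))
      (λ x≋y (x∈ , ≉0) → U.respects x≋y x∈ , λ ≈0 → ≉0 (trans (x≋y _) ≈0))
      (λ x → T? (U.contains x) ×-dec ¬? (right x zero ≟ 0#))

    -- The second scalar of a vector is its pairing with e. If it vanishes on all of U, maximality
    -- puts e into U; otherwise some vector of U scales to second scalar 1.
    pivot : Pivot
    pivot = choose transversal?
      where
      choose : Dec (∃ Transversal) → Pivot
      choose (yes (x , x∈ , ≉0)) with inverse ≉0
      ... | k , k∙≈1 = inj₂ (k ∙ left x zero , rest (k · x) ,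
        U.respects (≋.trans (≋.sym (extend-η (k · x))) (extend-scalars (rest (k · x)) refl k∙≈1)) (U.·-closed k x∈))
      choose (no none) = inj₁ (U.maximal e (form-extend-0 1# 𝟎 (hyperbolic.form-𝟎 {r})) λ y y∈ →
        trans (e-bil y) (decidable-stable (right y zero ≟ 0#) λ ≉0 → none (y , y∈ , ≉0)))

    -- Decides membership in the projection of the part of U orthogonal to e: the second scalar 0
    -- expresses orthogonality, and the free first scalar is what the projection forgets.
    section? : ∀ (x : H r) → Dec (∃[ s ] T (U.contains (extend s 0# x)))
    section? x = existsScalar? (λ s≈t → U.respects (extend-scalars x s≈t refl)) (λ s → T? (U.contains (extend s 0# x)))

    section∈ : ∀ s (x : H r) → T (U.contains (extend s 0# x)) → True (section? x)
    section∈ s x x∈ = fromWitness {a? = section? x} (s , x∈)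

    -- A vector x orthogonal to the projection has to be lifted to one orthogonal to U. If e is in
    -- U, then U is orthogonal to e and the first scalar is arbitrary; otherwise it is dictated by
    -- the pivot vector.
    quotient-maximal : Pivot → ∀ x → hyperbolic.form x ≈ 0# →
                       (∀ y → True (section? y) → hyperbolic.bil x y ≈ 0#) → True (section? x)
    quotient-maximal (inj₁ e∈) x fx≈0 x⊥ = section∈ 0# x (U.maximal (extend 0# 0# x) (form-extend-0 0# x fx≈0) λ y y∈ →
      let k≈0 : right y zero ≈ 0#
          k≈0 = trans (sym (e-bil y)) (U.orthogonal e y e∈ y∈)
      in begin
        hyperbolic.bil (extend 0# 0# x) y
          ≈⟨ hyperbolic.bil-cong {w = extend 0# 0# x} ≋.refl (extend-η y) ⟨
        hyperbolic.bil (extend 0# 0# x) (extend (left y zero) (right y zero) (rest y))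
          ≈⟨ bil-extend 0# 0# (left y zero) (right y zero) x (rest y) ⟩
        0# ∙ right y zero + left y zero ∙ 0# + hyperbolic.bil x (rest y)
          ≈⟨ +-congˡ (x⊥ (rest y) (section∈ _ (rest y) (U.respects (≋.trans (≋.sym (extend-η y)) (extend-scalars (rest y) refl k≈0)) y∈))) ⟩
        0# ∙ right y zero + left y zero ∙ 0# + 0#
          ≈⟨ solve 2 (λ l k → con (+ 0) :* k :+ l :* con (+ 0) :+ con (+ 0) := con (+ 0)) refl (left y zero) (right y zero) ⟩
        0# ∎)
    quotient-maximal (inj₂ (s , w , w∈)) x fx≈0 x⊥ = section∈ t x (U.maximal (extend t 0# x) (form-extend-0 t x fx≈0) λ y y∈ →
      let k = right y zero
          -- Subtracting k times the pivot vector from y clears the second scalar, so the rest lies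
          -- in the projection.
          reduced : T (U.contains (extend (- k ∙ s + left y zero) 0# (- k · w ⊕ rest y)))
          reduced = U.respects (≋.trans (⊕-cong ≋.refl (≋.sym (extend-η y))) (≋.trans (≋.sym (extend-axpy (- k) s 1# _ _ w (rest y)))
            (extend-scalars (- k · w ⊕ rest y) refl (solve 1 (λ k → :- k :* con (+ 1) :+ k := con (+ 0)) refl k)))) (U.axpy-closed (- k) w∈ y∈)
      in begin
        hyperbolic.bil (extend t 0# x) y
          ≈⟨ hyperbolic.bil-cong {w = extend t 0# x} ≋.refl (extend-η y) ⟨
        hyperbolic.bil (extend t 0# x) (extend (left y zero) k (rest y))
          ≈⟨ bil-extend t 0# (left y zero) k x (rest y) ⟩
        t ∙ k + left y zero ∙ 0# + hyperbolic.bil x (rest y)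
          ≈⟨ solve 4 (λ b k l c → :- b :* k :+ l :* con (+ 0) :+ c := :- k :* b :+ c) refl (hyperbolic.bil x w) k (left y zero) _ ⟩
        - k ∙ hyperbolic.bil x w + hyperbolic.bil x (rest y)
          ≈⟨ hyperbolic.bil-axpyʳ (- k) w (rest y) x ⟨
        hyperbolic.bil x (- k · w ⊕ rest y)
          ≈⟨ x⊥ _ (section∈ _ (- k · w ⊕ rest y) reduced) ⟩
        0# ∎)
      where
      -- The scalar that makes `extend t 0# x` orthogonal to the pivot vector `extend s 1# w`.
      t : Carrier
      t = - hyperbolic.bil x w

    quotient : MaximalSingular r
    quotient = record
      { contains    = λ x → isYes (section? x)
      ; respects    = λ {x} x≋y x∈ → let s , sx∈ = toWitness {a? = section? x} x∈
                                     in section∈ s _ (U.respects (extend-cong refl refl x≋y) sx∈)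
      ; axpy-closed = λ a {x} {y} x∈ y∈ →
          let s , sx∈ = toWitness {a? = section? x} x∈
              t , ty∈ = toWitness {a? = section? y} y∈
          in section∈ _ (a · x ⊕ y) (U.respects (≋.trans (≋.sym (extend-axpy a s 0# t 0# x y))
               (extend-scalars (a · x ⊕ y) refl (solve 1 (λ a → a :* con (+ 0) :+ con (+ 0) := con (+ 0)) refl a))) (U.axpy-closed a sx∈ ty∈))
      ; singular    = λ {x} x∈ → let s , sx∈ = toWitness {a? = section? x} x∈
                                 in trans (sym (trans (+-congʳ (zeroʳ s)) (+-identityˡ _))) (U.singular sx∈)
      ; maximal     = quotient-maximal pivot
      }

    -- Extends a code of the projection to a code of U. If e is in U, adding multiples of e adjusts
    -- the first scalar freely. Otherwise the pivot vector is normalised modulo sections, and its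
    -- right half in the frame of γ gives the functional.
    ascend : Pivot → (γ : Code r) → (∀ a → True (section? (element γ a))) →
             ∃[ δ ] ∀ a → T (U.contains (element {ℕ.suc r} δ a))
    ascend (inj₁ e∈) γ sub = (γ , zero) , λ a →
      let s , x∈ = toWitness {a? = section? (element γ (tail a))} (sub (tail a))
      in U.respects (≋.trans (≋.sym (extend-axpy (a zero - s) 1# 0# s 0# 𝟎 (element γ (tail a))))
           (≋.trans (extend-cong {x = (a zero - s) · 𝟎 ⊕ element γ (tail a)} (solve 2 (λ a s → (a :+ :- s) :* con (+ 1) :+ s := a) refl (a zero) s)
                                 (solve 2 (λ a s → (a :+ :- s) :* con (+ 0) :+ con (+ 0) := con (+ 0)) refl (a zero) s)
                                 (λ i → trans (+-congʳ (zeroʳ _)) (+-identityˡ _)))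
             (≋.sym (element-zero γ a)))) (U.axpy-closed (a zero - s) e∈ x∈)
    ascend (inj₂ (s , w , w∈)) γ sub = (γ , suc i) , λ a →
      let t , x∈ = toWitness {a? = section? (element γ (tail a))} (sub (tail a))
      in U.respects (≋.trans (≋.sym (extend-axpy (a zero) 0# 1# t 0# z (element γ (tail a))))
           (≋.trans (extend-cong
               -- Orthogonality to the normalised pivot vector forces t to be `- dot (tail a) κ`,
               -- which is the value of the functional with code i.
               (begin
                 a zero ∙ 0# + t
                   ≈⟨ solve 3 (λ a t d → a :* con (+ 0) :+ t := con (+ 0) :* con (+ 0) :+ t :* con (+ 1) :+ (con (+ 0) :+ d) :+ :- d) refl (a zero) t _ ⟩
                 0# ∙ 0# + t ∙ 1# + (0# + dot (tail a) κ) - dot (tail a) κ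
                   ≈⟨ +-congʳ (+-congˡ (+-congʳ (dot-𝟎ˡ {r} 𝟎))) ⟨
                 0# ∙ 0# + t ∙ 1# + hyperbolic.bil {r} [ 𝟎 , κ ] [ tail a , 𝟎 ] - dot (tail a) κ
                   ≈⟨ +-congʳ (+-congˡ (frame.bil-preserving γ [ 𝟎 , κ ] [ tail a , 𝟎 ])) ⟨
                 0# ∙ 0# + t ∙ 1# + hyperbolic.bil z (element γ (tail a)) - dot (tail a) κ
                   ≈⟨ +-congʳ (bil-extend 0# 1# t 0# z (element γ (tail a))) ⟨
                 hyperbolic.bil (extend 0# 1# z) (extend t 0# (element γ (tail a))) - dot (tail a) κ
                   ≈⟨ +-congʳ (U.orthogonal (extend 0# 1# z) (extend t 0# (element γ (tail a))) z∈ x∈) ⟩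
                 0# - dot (tail a) κ
                   ≈⟨ solve 1 (λ d → con (+ 0) :+ :- d := :- con (+ 1) :* d :+ con (+ 0)) refl _ ⟩
                 - 1# ∙ dot (tail a) κ + 0#
                   ≈⟨ +-congˡ (dot-𝟎ʳ (tail a)) ⟨
                 - 1# ∙ dot (tail a) κ + dot (tail a) 𝟎
                   ≈⟨ dot-axpyʳ (- 1#) κ 𝟎 (tail a) ⟨
                 dot (tail a) (- 1# · κ ⊕ 𝟎)
                   ≈⟨ dot-cong {u = tail a} ≋.refl (≋.trans (⊕-identityʳ (- 1# · κ)) (≋.sym vᵢ≋)) ⟩
                 dot (tail a) (vector {r} i) ∎)
               (solve 1 (λ a → a :* con (+ 1) :+ con (+ 0) := a) refl (a zero))
               (≋.trans (≋.sym (frame.axpy γ (a zero) [ 𝟎 , κ ] [ tail a , 𝟎 ]))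
                 (frame.cong γ λ { (inj₁ j) → trans (+-congʳ (zeroʳ _)) (+-identityˡ _)
                                 ; (inj₂ j) → trans (solve 2 (λ a k → a :* k :+ con (+ 0) := :- a :* (:- con (+ 1) :* k)) refl (a zero) (κ j))
                                                    (*-congˡ (sym (vᵢ≋ j))) })))
             (≋.sym (element-suc γ i a)))) (U.axpy-closed (a zero) z∈ x∈)
      where
      -- In the frame of γ, w has coordinates `left y` and κ. Subtracting the section above `left y`
      -- removes the left half and leaves z.
      y : H r
      y = proj₁ (isometry-surjective (frame γ) w)
      y↦w : frame.fun γ y ≋ w
      y↦w = proj₂ (isometry-surjective (frame γ) w)
      κ : V r
      κ = right y
      z : H r
      z = frame.fun γ [ 𝟎 , κ ]
      i : Fin (q ^ r)
      i = Inverse.to (vectors r) (- 1# · κ)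
      vᵢ≋ : vector {r} i ≋ - 1# · κ
      vᵢ≋ = Inverse.strictlyInverseʳ (vectors r) (- 1# · κ)
      low : ∃[ t ] T (U.contains (extend t 0# (element γ (left y))))
      low = toWitness {a? = section? (element γ (left y))} (sub (left y))
      s′ : Carrier
      s′ = - 1# ∙ proj₁ low + s
      z∈′ : T (U.contains (extend s′ 1# z))
      z∈′ = U.respects (≋.trans (≋.sym (extend-axpy (- 1#) (proj₁ low) 0# s 1# (element γ (left y)) w))
        (extend-cong refl (solve 0 (:- con (+ 1) :* con (+ 0) :+ con (+ 1) := con (+ 1)) refl)
          (≋.trans (⊕-cong ≋.refl (≋.sym y↦w)) (≋.trans (≋.sym (frame.axpy γ (- 1#) [ left y , 𝟎 ] y))
            (frame.cong γ λ { (inj₁ j) → solve 1 (λ x → :- con (+ 1) :* x :+ x := con (+ 0)) refl (left y j)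
                            ; (inj₂ j) → solve 1 (λ x → :- con (+ 1) :* con (+ 0) :+ x := x) refl (κ j) })))))
        (U.axpy-closed (- 1#) (proj₂ low) w∈)
      -- Since z has form 0 and the second scalar is 1, singularity leaves no freedom for the first
      -- scalar.
      s′≈0 : s′ ≈ 0#
      s′≈0 = begin
        s′                                             ≈⟨ solve 1 (λ s → s := s :* con (+ 1) :+ con (+ 0)) refl s′ ⟩
        s′ ∙ 1# + 0#                                   ≈⟨ +-congˡ (dot-𝟎ˡ κ) ⟨
        s′ ∙ 1# + hyperbolic.form {r} [ 𝟎 , κ ]        ≈⟨ +-congˡ (frame.isometric γ [ 𝟎 , κ ]) ⟨
        hyperbolic.form (extend s′ 1# z)               ≈⟨ U.singular z∈′ ⟩
        0#                                             ∎
      z∈ : T (U.contains (extend 0# 1# z))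
      z∈ = U.respects (extend-scalars z s′≈0 refl) z∈′

  -- Every generator contains one with a code, by descent to the projection along e;
  -- `complete-converse` turns the inclusion into equality.
  complete : ∀ {r} (U : MaximalSingular r) → ∃[ γ ] ∀ a → T (MaximalSingular.contains U (element {r} γ a))
  complete {ℕ.zero}  U = tt , λ a → MaximalSingular.maximal U _ refl λ _ _ → +-identityˡ 0#
  complete {ℕ.suc r} U = ascend pivot (proj₁ (complete quotient)) (proj₂ (complete quotient))
    where open Descend U

  complete-converse : ∀ {r} (U : MaximalSingular r) (γ : Code r) → (∀ a → T (MaximalSingular.contains U (element γ a))) →
                      ∀ x → T (MaximalSingular.contains U x) → ∃[ a ] element γ a ≋ x
  complete-converse U γ sub x x∈ = element-maximal γ x λ a → MaximalSingular.orthogonal U x (element γ a) x∈ (sub a)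

  -- Subspaces of a quadratic space

  -- The Siegel transformation that fixes f and moves e to `extend 1# (- hyperbolic.form w) w`. It
  -- supplies explicitly the transitivity on singular points that Witt's theorem would give.
  siegel : ∀ {r} → H r → Isometry (hyperbolic (ℕ.suc r)) (hyperbolic (ℕ.suc r))
  siegel {r} w = record
    { fun       = λ x → extend (left x zero) (right x zero - left x zero ∙ hyperbolic.form w - hyperbolic.bil w (rest x))
                               (left x zero · w ⊕ rest x)
    ; isLinear  = record
      { cong = λ x≋y → extend-cong (x≋y _)
          (+-cong (+-cong (x≋y _) (-‿cong (*-congʳ (x≋y _)))) (-‿cong (hyperbolic.bil-cong {w = w} {x = w} ≋.refl (rest-cong x≋y))))
          (⊕-cong (·-cong {x = w} (x≋y _) ≋.refl) (rest-cong x≋y))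
      ; axpy = λ a x y → ≋.trans (extend-cong {x = (a ∙ left x zero + left y zero) · w ⊕ rest (a · x ⊕ y)} refl
            (trans (+-congˡ (-‿cong (trans (hyperbolic.bil-cong {w = w} {x = w} ≋.refl (rest-axpy a x y)) (hyperbolic.bil-axpyʳ a (rest x) (rest y) w))))
              (solve 8 (λ a k k′ l l′ f b b′ → (a :* k :+ k′) :+ :- ((a :* l :+ l′) :* f) :+ :- (a :* b :+ b′)
                          := a :* (k :+ :- (l :* f) :+ :- b) :+ (k′ :+ :- (l′ :* f) :+ :- b′)) refl
                 a (right x zero) (right y zero) (left x zero) (left y zero) (hyperbolic.form w) _ _))
            (λ i → trans (+-congˡ (rest-axpy a x y i))
              (solve 6 (λ a l l′ w s t → (a :* l :+ l′) :* w :+ (a :* s :+ t) := a :* (l :* w :+ s) :+ (l′ :* w :+ t)) refl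
                 a (left x zero) (left y zero) (w i) (rest x i) (rest y i))))
          (extend-axpy a _ _ _ _ (left x zero · w ⊕ rest x) (left y zero · w ⊕ rest y))
      }
    ; isometric = λ x → trans (+-congˡ (hyperbolic.form-axpy (left x zero) w (rest x)))
        (solve 5 (λ l k f b g → l :* (k :+ :- (l :* f) :+ :- b) :+ (l :* l :* f :+ l :* b :+ g) := l :* k :+ g) refl
           (left x zero) (right x zero) (hyperbolic.form w) (hyperbolic.bil w (rest x)) (hyperbolic.form (rest x)))
    }

  translate : ∀ {r} {J : Set} {Q : Quadratic J} → Isometry (hyperbolic (ℕ.suc r)) Q → H r → Isometry (hyperbolic (ℕ.suc r)) Q
  translate {r} {Q = Q} θ w = _∘ᵢ_ {P = hyperbolic (ℕ.suc r)} {Q = hyperbolic (ℕ.suc r)} {R = Q} θ (siegel w)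

  isotropic : ∀ {r} → H (ℕ.suc r)
  isotropic = extend 1# 0# 𝟎

  siegel-isotropic : ∀ {r} (w : H r) → Isometry.fun (siegel w) isotropic ≋ extend 1# (- hyperbolic.form w) w
  siegel-isotropic {r} w = extend-cong {x′ = w} refl
    (trans (+-congˡ (-‿cong (trans (hyperbolic.bil-cong {w = w} {x = w} ≋.refl rest-e≋𝟎) (hyperbolic.bil-𝟎ʳ w))))
           (solve 1 (λ f → con (+ 0) :+ :- (con (+ 1) :* f) :+ :- con (+ 0) := :- f) refl (hyperbolic.form w)))
    (λ i → trans (+-congˡ (rest-e≋𝟎 i)) (solve 1 (λ w → con (+ 1) :* w :+ con (+ 0) := w) refl (w i)))
    where
    rest-e≋𝟎 : rest (isotropic {r}) ≋ 𝟎
    rest-e≋𝟎 (inj₁ i) = refl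
    rest-e≋𝟎 (inj₂ i) = refl

  -- Turns non-orthogonality of two points into nonsingularity of the difference of their
  -- parameters.
  siegel-isotropic-bil : ∀ {r} (w w′ : H r) →
    hyperbolic.bil (Isometry.fun (siegel w) isotropic) (Isometry.fun (siegel w′) isotropic) ≈ - hyperbolic.form (- 1# · w′ ⊕ w)
  siegel-isotropic-bil w w′ = begin
    hyperbolic.bil (Isometry.fun (siegel w) isotropic) (Isometry.fun (siegel w′) isotropic)
      ≈⟨ hyperbolic.bil-cong (siegel-isotropic w) (siegel-isotropic w′) ⟩
    hyperbolic.bil (extend 1# (- hyperbolic.form w) w) (extend 1# (- hyperbolic.form w′) w′)
      ≈⟨ bil-extend 1# (- hyperbolic.form w) 1# (- hyperbolic.form w′) w w′ ⟩
    1# ∙ - hyperbolic.form w′ + 1# ∙ - hyperbolic.form w + hyperbolic.bil w w′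
      ≈⟨ +-congˡ (hyperbolic.bil-sym w w′) ⟩
    1# ∙ - hyperbolic.form w′ + 1# ∙ - hyperbolic.form w + hyperbolic.bil w′ w
      ≈⟨ solve 3 (λ f b g → con (+ 1) :* :- f :+ con (+ 1) :* :- g :+ b := :- (:- con (+ 1) :* :- con (+ 1) :* f :+ :- con (+ 1) :* b :+ g)) refl
           (hyperbolic.form w′) (hyperbolic.bil w′ w) (hyperbolic.form w) ⟩
    - (- 1# ∙ - 1# ∙ hyperbolic.form w′ + - 1# ∙ hyperbolic.bil w′ w + hyperbolic.form w)
      ≈⟨ -‿cong (hyperbolic.form-axpy (- 1#) w′ w) ⟨
    - hyperbolic.form (- 1# · w′ ⊕ w) ∎

  ambient : ∀ {d} → QuadraticForm d → Quadratic (Fin d)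
  ambient Q .Quadratic.form = QuadraticForm.form Q
  ambient Q .Quadratic.bil = QuadraticForm.polar Q
  ambient Q .Quadratic.form-cong = QuadraticForm.form-cong Q
  ambient Q .Quadratic.bil-cong w≋x y≋z =
    +-cong (+-cong (form-cong (⊕-cong w≋x y≋z)) (-‿cong (form-cong w≋x))) (-‿cong (form-cong y≋z))
    where open QuadraticForm Q
  ambient Q .Quadratic.bil-axpyˡ a x y z = trans (polar-additive (a · x) y z) (+-congʳ (polar-homogeneous a x z))
    where open QuadraticForm Q
  ambient Q .Quadratic.bil-sym x y = begin
    form (x ⊕ y) - form x - form y  ≈⟨ +-congʳ (+-congʳ (form-cong (λ i → +-comm (x i) (y i)))) ⟩
    form (y ⊕ x) - form x - form y  ≈⟨ solve 3 (λ f g h → f :+ :- g :+ :- h := f :+ :- h :+ :- g) refl _ _ _ ⟩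
    form (y ⊕ x) - form y - form x  ∎
    where open QuadraticForm Q
  ambient Q .Quadratic.form-axpy a x y = begin
    form (a · x ⊕ y)
      ≈⟨ solve 3 (λ f g h → f := g :+ (f :+ :- g :+ :- h) :+ h) refl (form (a · x ⊕ y)) (form (a · x)) (form y) ⟩
    form (a · x) + polar (a · x) y + form y
      ≈⟨ +-congʳ (+-cong (homogeneous a x) (polar-homogeneous a x y)) ⟩
    a ∙ a ∙ form x + a ∙ polar x y + form y ∎
    where open QuadraticForm Q

  combination-isLinear : ∀ {d k} (b : Vector (V d) k) → IsLinear (λ a → combination a b)
  combination-isLinear b = record
    { cong = λ a≋a′ j → dot-cong {v = λ i → b i j} a≋a′ ≋.refl
    ; axpy = λ s x y j → dot-axpyˡ s x y (λ i → b i j)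
    }

  unit : ∀ {k} → Fin k → V k
  unit zero    = 1# ∷ 𝟎
  unit (suc i) = 0# ∷ unit i

  linear-expand : ∀ {d k} {ι : V k → V d} → IsLinear ι → ∀ a → ι a ≋ combination a (ι ∘ unit)
  linear-expand {k = ℕ.zero}  {ι} lin a j = trans (cong {a} {𝟎} (λ ()) j) (𝟎-homo j)
    where open IsLinear lin
  linear-expand {k = ℕ.suc k} {ι} lin a j = begin
    ι a j
      ≈⟨ cong (λ { zero    → solve 1 (λ a → a := a :* con (+ 1) :+ con (+ 0)) refl (a zero)
                 ; (suc i) → solve 2 (λ a b → b := a :* con (+ 0) :+ b) refl (a zero) (a (suc i)) }) j ⟩
    ι (a zero · (1# ∷ 𝟎) ⊕ (0# ∷ tail a)) j
      ≈⟨ axpy (a zero) (1# ∷ 𝟎) (0# ∷ tail a) j ⟩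
    a zero ∙ ι (1# ∷ 𝟎) j + ι (0# ∷ tail a) j
      ≈⟨ +-congˡ (linear-expand (∘-isLinear lin 0∷-linear) (tail a) j) ⟩
    combination a (ι ∘ unit) j ∎
    where
    open IsLinear lin

  module Span {d k : ℕ} {ι : V k → V d} (lin : IsLinear ι) where

    open IsLinear lin

    -- Searching for a preimage provides the Boolean membership that `Subspace` requires.
    preimage? : ∀ v → Dec (∃[ a ] ι a ≋ v)
    preimage? v = Finite.exists? (functions (Fin k)) (vectors k) (λ a≋b ιa≋v → ≋.trans (cong (≋.sym a≋b)) ιa≋v)
                    (λ a → Finite._≟_ (functions (Fin d)) (vectors d) (ι a) v)

    ∈-span : ∀ {v} a → ι a ≋ v → True (preimage? v)
    ∈-span {v} a ιa≋v = fromWitness {a? = preimage? v} (a , ιa≋v)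

    span-∈ : ∀ v → True (preimage? v) → ∃[ a ] ι a ≋ v
    span-∈ v = toWitness {a? = preimage? v}

    span : Subspace d
    span = record
      { member   = λ v → isYes (preimage? v)
      ; respects = λ {v} {w} v≋w → T-extensional
          (λ v∈ → let a , eq = span-∈ v v∈ in ∈-span a (≋.trans eq v≋w))
          (λ w∈ → let a , eq = span-∈ w w∈ in ∈-span a (≋.trans eq (≋.sym v≋w)))
      ; 𝟎-closed = ∈-span 𝟎 𝟎-homo
      ; ⊕-closed = λ {v} {w} v∈ w∈ → let a , a↦v = span-∈ v v∈ ; b , b↦w = span-∈ w w∈
                                     in ∈-span (a ⊕ b) (≋.trans (⊕-homo a b) (⊕-cong a↦v b↦w))
      ; ·-closed = λ s {v} v∈ → let a , a↦v = span-∈ v v∈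
                                in ∈-span (s · a) (≋.trans (·-homo s a) (·-cong refl a↦v))
      }

    span-dimension : (∀ a → ι a ≋ 𝟎 → a ≋ 𝟎) → HasDimension span k
    span-dimension kernel = record
      { basis       = ι ∘ unit
      ; basis∈      = λ i → ∈-span (unit i) ≋.refl
      ; independent = λ a comb≋𝟎 → kernel a (≋.trans (linear-expand lin a) comb≋𝟎)
      ; spanning    = λ v v∈ → let a , a↦v = span-∈ v v∈ in a , ≋.trans (≋.sym a↦v) (linear-expand lin a)
      }

    span-singular : (Q : QuadraticForm d) → (∀ a → QuadraticForm.form Q (ι a) ≈ 0#) → TotallySingular Q span
    span-singular Q sing v v∈ = let a , a↦v = span-∈ v v∈ in trans (QuadraticForm.form-cong Q (≋.sym a↦v)) (sing a)

    spanSpace : (Q : QuadraticForm d) → (∀ a → ι a ≋ 𝟎 → a ≋ 𝟎) → (∀ a → QuadraticForm.form Q (ι a) ≈ 0#) → SingularSpace Q k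
    spanSpace Q kernel sing = record
      { space     = span
      ; dimension = span-dimension kernel
      ; singular  = span-singular Q sing
      }

  left-embedding : ∀ {r} → IsLinear {Fin r} {Fin r ⊎ Fin r} (λ l → [ l , 𝟎 ])
  left-embedding = record
    { cong = λ l≋l′ → pair-cong l≋l′ ≋.refl
    ; axpy = λ { a x y (inj₁ i) → refl
               ; a x y (inj₂ i) → solve 1 (λ a → con (+ 0) := a :* con (+ 0) :+ con (+ 0)) refl a }
    }

  isometry-≤ : ∀ {r d} {Q : Quadratic (Fin d)} → Isometry (hyperbolic r) Q → q ^ r ℕ.* q ^ r ≤ q ^ d
  isometry-≤ {r} {d} θ = injective⇒≤ (cardinality-H r) (vectors d) (Isometry.fun θ) (isometry-injective θ)

  isometry-onto : ∀ {r} {Q : Quadratic (Fin (r ℕ.+ r))} (θ : Isometry (hyperbolic r) Q) → ∀ v → ∃[ x ] Isometry.fun θ x ≋ v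
  isometry-onto {r} θ = injective⇒surjective (cardinality-H r)
    (≡.subst (HasCardinality (functions (Fin (r ℕ.+ r)))) (ℕ.^-distribˡ-+-* q r r) (vectors (r ℕ.+ r)))
    (Isometry.fun θ) (Isometry.cong θ) (isometry-injective θ)

  isometry-oversized : ∀ {r} {Q : Quadratic (Fin (r ℕ.+ r))} → ¬ Isometry (hyperbolic (ℕ.suc r)) Q
  isometry-oversized {r} {Q} θ = ℕ.<⇒≱ (ℕ.^-monoʳ-< q 1<q (ℕ.+-mono-< (ℕ.n<1+n r) (ℕ.n<1+n r)))
    (≡.subst (_≤ q ^ (r ℕ.+ r)) (≡.sym (ℕ.^-distribˡ-+-* q (ℕ.suc r) (ℕ.suc r))) (isometry-≤ {ℕ.suc r} {r ℕ.+ r} {Q} θ))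

  -- The dimension is written as `suc n ℕ.+ suc n` to count vectors by halves; it computes to 10 at
  -- n = 4. Generators through a fixed point will be matched with codes of rank n.
  module Correspondence {n : ℕ} (Q : QuadraticForm (ℕ.suc n ℕ.+ ℕ.suc n)) (nondegenerate : Nondegenerate Q) where

    private
      r : ℕ
      r = ℕ.suc n

    module A = Quadratic (ambient Q)
    open Witt (ambient Q) nondegenerate using (embedding)

    -- Otherwise a totally singular subspace of dimension r + 1 would embed a
    -- hyperbolic space with q ^ (2 r + 2) vectors in one with q ^ (2 r).
    module WittIndex (U : SingularSpace Q r) (x : V (r ℕ.+ r)) (x-sing : A.form x ≈ 0#)
      (x⊥U : ∀ y → y ∈ SingularSpace.space U → A.bil x y ≈ 0#) where

      open SingularSpace U
      open HasDimension dimension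
      private module C = IsLinear (combination-isLinear basis)

      ι : V (ℕ.suc r) → V (r ℕ.+ r)
      ι a = a zero · x ⊕ combination (tail a) basis

      ι-linear : IsLinear ι
      ι-linear = record
        { cong = λ a≋b → ⊕-cong (·-cong {x = x} (a≋b zero) ≋.refl) (C.cong (a≋b ∘ suc))
        ; axpy = λ s a b i → trans (+-congˡ (C.axpy s (tail a) (tail b) i))
            (solve 6 (λ s a b x u v → (s :* a :+ b) :* x :+ (s :* u :+ v) := s :* (a :* x :+ u) :+ (b :* x :+ v)) refl
               s (a zero) (b zero) (x i) _ _)
        }

      ι-singular : ∀ a → A.form (ι a) ≈ 0#
      ι-singular a = begin
        A.form (ι a)
          ≈⟨ A.form-axpy (a zero) x u ⟩
        a zero ∙ a zero ∙ A.form x + a zero ∙ A.bil x u + A.form u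
          ≈⟨ +-cong (+-cong (*-congˡ x-sing) (*-congˡ (x⊥U u u∈))) (singular u u∈) ⟩
        a zero ∙ a zero ∙ 0# + a zero ∙ 0# + 0#
          ≈⟨ solve 1 (λ a → a :* a :* con (+ 0) :+ a :* con (+ 0) :+ con (+ 0) := con (+ 0)) refl (a zero) ⟩
        0# ∎
        where
        u : V (r ℕ.+ r)
        u = combination (tail a) basis
        u∈ : u ∈ space
        u∈ = combination∈ space (tail a) basis basis∈

      module _ (x∉U : ¬ x ∈ space) where

        -- A nonzero coefficient of x could be inverted and would place x in U; with that
        -- coefficient zero, the basis is independent.
        ι-kernel : ∀ a → ι a ≋ 𝟎 → a ≋ 𝟎
        ι-kernel a ιa≋𝟎 = λ
          { zero    → a₀≈0
          ; (suc i) → independent (tail a) (λ j → begin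
              combination (tail a) basis j
                ≈⟨ solve 2 (λ x u → u := con (+ 0) :* x :+ u) refl (x j) _ ⟩
              0# ∙ x j + combination (tail a) basis j
                ≈⟨ +-congʳ (*-congʳ a₀≈0) ⟨
              ι a j
                ≈⟨ ιa≋𝟎 j ⟩
              0# ∎) i
          }
          where
          u∈ : combination (tail a) basis ∈ space
          u∈ = combination∈ space (tail a) basis basis∈
          x∈ : ∃[ s ] s ∙ a zero ≈ 1# → x ∈ space
          x∈ (s , sa≈1) = ≡.subst T (Subspace.respects space λ j → begin
            - s ∙ combination (tail a) basis j
              ≈⟨ solve 4 (λ s a x u → :- s :* u := s :* a :* x :+ :- s :* (a :* x :+ u)) refl s (a zero) (x j) _ ⟩
            s ∙ a zero ∙ x j + - s ∙ ι a j
              ≈⟨ +-cong (*-congʳ sa≈1) (*-congˡ (ιa≋𝟎 j)) ⟩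
            1# ∙ x j + - s ∙ 0#
              ≈⟨ solve 2 (λ s x → con (+ 1) :* x :+ :- s :* con (+ 0) := x) refl s (x j) ⟩
            x j ∎) (Subspace.·-closed space (- s) u∈)
          a₀≈0 : a zero ≈ 0#
          a₀≈0 = decidable-stable (a zero ≟ 0#) λ a₀≉0 → x∉U (x∈ (inverse a₀≉0))

        impossible : ⊥
        impossible = isometry-oversized {r} {ambient Q} (embedding {ℕ.suc r} ι ι-linear ι-kernel ι-singular)

      absorbed : x ∈ space
      absorbed = decidable-stable (T? (member space x)) impossible

    coordinates : SingularSpace Q r → Isometry (hyperbolic r) (ambient Q)
    coordinates U = embedding {r} (λ a → combination a basis) (combination-isLinear basis) independent
                             (λ a → singular _ (combination∈ space a basis basis∈))
      where
      open SingularSpace U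
      open HasDimension dimension

    module Framed (θ : Isometry (hyperbolic r) (ambient Q)) where

      open Isometry θ

      surjective : ∀ v → ∃[ x ] fun x ≋ v
      surjective = isometry-onto {r} {ambient Q} θ

      vertex : V (r ℕ.+ r)
      vertex = fun isotropic

      -- Trades the dimension r of U for maximality, by way of `WittIndex`.
      pullback : SingularSpace Q r → MaximalSingular r
      pullback U = record
        { contains    = λ x → member space (fun x)
        ; respects    = λ x≋y → ≡.subst T (Subspace.respects space (cong x≋y))
        ; axpy-closed = λ a {x} {y} x∈ y∈ → ≡.subst T (Subspace.respects space (≋.sym (axpy a x y)))
                          (Subspace.⊕-closed space (Subspace.·-closed space a x∈) y∈)
        ; singular    = λ {x} x∈ → trans (sym (isometric x)) (singular (fun x) x∈)
        ; maximal     = λ x fx≈0 x⊥ → WittIndex.absorbed U (fun x) (trans (isometric x) fx≈0) λ v v∈ →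
            let y , y↦v = surjective v in begin
              A.bil (fun x) v          ≈⟨ A.bil-cong {w = fun x} ≋.refl y↦v ⟨
              A.bil (fun x) (fun y)    ≈⟨ bil-preserving x y ⟩
              hyperbolic.bil x y       ≈⟨ x⊥ y (≡.subst T (Subspace.respects space (≋.sym y↦v)) v∈) ⟩
              0#                       ∎
        }
        where open SingularSpace U

      -- Fixing the last choice at `zero` means that the generator contains e, so a code of rank n
      -- describes a generator through `vertex`.
      ι : Code n → V r → V (r ℕ.+ r)
      ι γ a = fun (element {r} (γ , zero) a)

      ι-linear : ∀ γ → IsLinear (ι γ)
      ι-linear γ = ∘-isLinear isLinear (∘-isLinear (frame.isLinear {r} (γ , zero)) left-embedding)

      ι-injective : ∀ γ {a b} → ι γ a ≋ ι γ b → a ≋ b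
      ι-injective γ {a} {b} eq i = isometry-injective {r} {Q = hyperbolic r} (frame {r} (γ , zero)) {[ a , 𝟎 ]} {[ b , 𝟎 ]}
        (isometry-injective {r} {Q = ambient Q} θ {element {r} (γ , zero) a} {element {r} (γ , zero) b} eq) (inj₁ i)

      private module ι γ = Span (ι-linear γ)

      generator : Code n → SingularSpace Q r
      generator γ = ι.spanSpace γ Q
        (λ a ιa≋𝟎 → ι-injective γ (≋.trans ιa≋𝟎 (≋.sym (IsLinear.𝟎-homo (ι-linear γ)))))
        (λ a → trans (isometric _) (trans (frame.isometric {r} (γ , zero) [ a , 𝟎 ]) (dot-𝟎ʳ a)))

      vertex∈generator : ∀ γ → vertex ∈ SingularSpace.space (generator γ)
      vertex∈generator γ = ι.∈-span γ (1# ∷ 𝟎) (cong (≋.trans (element-zero γ (1# ∷ 𝟎))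
        (extend-cong {x′ = 𝟎} refl refl (≋.trans (frame.cong γ λ { (inj₁ i) → refl ; (inj₂ i) → refl }) (frame.𝟎-homo γ)))))

      generator-injective : ∀ {γ δ} → Setoid._≈_ (singularSpaces Q r) (generator γ) (generator δ) → γ ≡ δ
      generator-injective {γ} {δ} γ≈δ = ≡.cong proj₁ (element-injective {r} (γ , zero) (δ , zero) λ a →
        let b , eq = ι.span-∈ δ (ι γ a) (≡.subst T (γ≈δ (ι γ a)) (ι.∈-span γ a ≋.refl))
        in b , isometry-injective {r} {Q = ambient Q} θ {element {r} (γ , zero) a} {element {r} (δ , zero) b} (≋.sym eq))

      generator-surjective : ∀ U → vertex ∈ SingularSpace.space U → ∃[ γ ] Setoid._≈_ (singularSpaces Q r) (generator γ) U
      generator-surjective U vertex∈ = γ , λ v → T-extensional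
        (λ v∈ → let a , eq = ι.span-∈ γ v v∈ in ≡.subst T (Subspace.respects space eq) (sub a))
        (λ v∈ → let x , x↦v = surjective v
                    a , eq = complete-converse (pullback U) (γ , zero) sub x (≡.subst T (Subspace.respects space (≋.sym x↦v)) v∈)
                in ι.∈-span γ a (≋.trans (cong eq) x↦v))
        where
        open SingularSpace U using (space)
        open Descend (pullback U)
        γ : Code n
        γ = proj₁ (complete quotient)
        sub : ∀ a → ι γ a ∈ space
        -- The pivot is given as e itself and not searched for, so the resulting code ends in `zero`
        -- by computation.
        sub = proj₂ (ascend (inj₁ vertex∈) γ (proj₂ (complete quotient)))

  -- The Hermitian unital in characteristic 3

  module CharacteristicThree (h : ℕ) (q≡3^h : q ≡ 3 ^ h) where

    open import Algebra.Properties.CommutativeMonoid.Sum +-commutativeMonoid using (sum-permute; ∑-distrib-+; sum-replicate)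
    open import Algebra.Properties.Semiring.Mult semiring using (×1-homo-*) renaming (_×_ to _⋆_)

    -- The unfolding of `3 ⋆ 1#`, so that `×1-homo-*` yields it directly.
    three : Carrier
    three = 1# + (1# + (1# + 0#))

    -- Translation by 1 permutes the field, so it does not change the sum of all elements.
    order⋆1≈0 : q ⋆ 1# ≈ 0#
    order⋆1≈0 = begin
      q ⋆ 1#
        ≈⟨ solve 2 (λ s t → t := :- s :+ (s :+ t)) refl (sum from) (q ⋆ 1#) ⟩
      - sum from + (sum from + q ⋆ 1#)
        ≈⟨ +-congˡ (+-congˡ (sum-replicate q)) ⟨
      - sum from + (sum from + sum (λ (_ : Fin q) → 1#))
        ≈⟨ +-congˡ (∑-distrib-+ from (λ _ → 1#)) ⟨
      - sum from + sum (λ i → from i + 1#)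
        ≈⟨ +-congˡ (sum-cong-≋ (λ i → strictlyInverseʳ (from i + 1#))) ⟨
      - sum from + sum (λ i → from (to (from i + 1#)))
        ≈⟨ +-congˡ (sum-permute from translation) ⟨
      - sum from + sum from
        ≈⟨ -‿inverseˡ _ ⟩
      0# ∎
      where
      open Inverse F≅q
      cancel : ∀ s t → (∀ x → x + s + t ≈ x) → ∀ i → to (from (to (from i + s)) + t) ≡ i
      cancel s t eq i = ≡.trans (to-cong (trans (+-congʳ (strictlyInverseʳ _)) (eq _))) (strictlyInverseˡ i)
      translation : Permutation q q
      translation = permutation (λ i → to (from i + 1#)) (λ i → to (from i - 1#))
        (cancel (- 1#) 1# λ x → solve 1 (λ x → x :+ :- con (+ 1) :+ con (+ 1) := x) refl x)
        (cancel 1# (- 1#) λ x → solve 1 (λ x → x :+ con (+ 1) :+ :- con (+ 1) := x) refl x)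

    -- If 3 were nonzero, so would be each of its powers, among them the order of the field.
    three≈0 : three ≈ 0#
    three≈0 = decidable-stable (three ≟ 0#) λ three≉0 → powers≉0 three≉0 h (≡.subst (λ m → m ⋆ 1# ≈ 0#) q≡3^h order⋆1≈0)
      where
      powers≉0 : ¬ three ≈ 0# → ∀ k → ¬ (3 ^ k) ⋆ 1# ≈ 0#
      powers≉0 three≉0 ℕ.zero    eq = 1≉0 (trans (sym (+-identityʳ 1#)) eq)
      powers≉0 three≉0 (ℕ.suc k) eq = powers≉0 three≉0 k (integral three≉0 (trans (sym (×1-homo-* 3 (3 ^ k))) eq))

    1≉-1 : ¬ 1# ≈ - 1#
    1≉-1 1≈-1 = 1≉0 (begin
      1#                       ≈⟨ solve 0 (con (+ 1) := con (+ 1) :+ (con (+ 1) :+ (con (+ 1) :+ con (+ 0))) :+ :- con (+ 1) :+ :- con (+ 1)) refl ⟩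
      three - 1# + - 1#        ≈⟨ +-cong (+-congʳ three≈0) (sym 1≈-1) ⟩
      0# - 1# + 1#             ≈⟨ solve 0 (con (+ 0) :+ :- con (+ 1) :+ con (+ 1) := con (+ 0)) refl ⟩
      0#                       ∎)

    root? : ∀ x → Dec (∃[ y ] y ∙ y ≈ x)
    root? x = existsScalar? (λ y≈z yy≈x → trans (*-cong (sym y≈z) (sym y≈z)) yy≈x) (λ y → y ∙ y ≟ x)

    NonSquare : Carrier → Set (c ⊔ ℓ₁)
    NonSquare x = ¬ (∃[ y ] y ∙ y ≈ x)

    nonSquare : ∃ NonSquare
    nonSquare = decide (existsScalar? (λ x≈x′ ¬root (y , yy≈x′) → ¬root (y , trans yy≈x′ (sym x≈x′))) (λ x → ¬? (root? x)))
      where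
      open Inverse F≅q
      -- A choice of square roots would be an injection, hence a surjection hitting both 1 and - 1.
      decide : Dec (∃ NonSquare) → ∃ NonSquare
      decide (yes found) = found
      decide (no  none)  = contradiction (begin
          1#                        ≈⟨ proj₂ (hit 1#) ⟨
          root (proj₁ (hit 1#))     ≡⟨ ≡.cong root (from-injective (begin
              from (proj₁ (hit 1#))                            ≈⟨ root² _ ⟨
              root (proj₁ (hit 1#)) ∙ root (proj₁ (hit 1#))    ≈⟨ *-cong (proj₂ (hit 1#)) (proj₂ (hit 1#)) ⟩
              1# ∙ 1#                                          ≈⟨ solve 0 (con (+ 1) :* con (+ 1) := :- con (+ 1) :* :- con (+ 1)) refl ⟩
              - 1# ∙ - 1#                                      ≈⟨ *-cong (proj₂ (hit (- 1#))) (proj₂ (hit (- 1#))) ⟨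
              root (proj₁ (hit (- 1#))) ∙ root (proj₁ (hit (- 1#)))  ≈⟨ root² _ ⟩
              from (proj₁ (hit (- 1#)))                        ∎)) ⟩
          root (proj₁ (hit (- 1#)))  ≈⟨ proj₂ (hit (- 1#)) ⟩
          - 1#                       ∎) 1≉-1
        where
        rooted : ∀ x → ∃[ y ] y ∙ y ≈ x
        rooted x = decidable-stable (root? x) λ ¬root → none (x , ¬root)
        root : Fin q → Carrier
        root i = proj₁ (rooted (from i))
        root² : ∀ i → root i ∙ root i ≈ from i
        root² i = proj₂ (rooted (from i))
        from-injective : ∀ {i j} → from i ≈ from j → i ≡ j
        from-injective eq = ≡.trans (≡.sym (strictlyInverseˡ _)) (≡.trans (to-cong eq) (strictlyInverseˡ _))
        hit : ∀ x → ∃[ i ] root i ≈ x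
        hit = injective⇒surjective {S = ≡.setoid (Fin q)} {T = setoid} (↔-id (Fin q)) F≅q root (λ { ≡.refl → refl })
                (λ {i} {j} eq → from-injective (trans (sym (root² i)) (trans (*-cong eq eq) (root² j))))

    ν : Carrier
    ν = proj₁ nonSquare

    -- The norm of x + i y in the quadratic extension with i² = ν; the extension field itself is
    -- never constructed.
    norm : Carrier → Carrier → Carrier
    norm x y = x ∙ x - ν ∙ (y ∙ y)

    -- A zero with y nonzero would make ν the square of x / y.
    norm-anisotropic : ∀ {x y} → norm x y ≈ 0# → x ≈ 0# × y ≈ 0#
    norm-anisotropic {x} {y} eq = x≈0 , y≈0
      where
      root : ∃[ s ] s ∙ y ≈ 1# → ∃[ t ] t ∙ t ≈ ν
      root (s , sy≈1) = s ∙ x , (begin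
        s ∙ x ∙ (s ∙ x)
          ≈⟨ solve 4 (λ s x y n → s :* x :* (s :* x) := s :* s :* (x :* x :+ :- (n :* (y :* y))) :+ (s :* y) :* (s :* y) :* n) refl s x y ν ⟩
        s ∙ s ∙ norm x y + (s ∙ y) ∙ (s ∙ y) ∙ ν
          ≈⟨ +-cong (*-congˡ eq) (*-congʳ (*-cong sy≈1 sy≈1)) ⟩
        s ∙ s ∙ 0# + 1# ∙ 1# ∙ ν
          ≈⟨ solve 2 (λ s n → s :* s :* con (+ 0) :+ con (+ 1) :* con (+ 1) :* n := n) refl s ν ⟩
        ν ∎)
      y≈0 : y ≈ 0#
      y≈0 = decidable-stable (y ≟ 0#) λ y≉0 → proj₂ nonSquare (root (inverse y≉0))
      x≈0 : x ≈ 0#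
      x≈0 = decidable-stable (x ≟ 0#) λ x≉0 → x≉0 (integral x≉0 (begin
        x ∙ x                       ≈⟨ solve 3 (λ x y n → x :* x := x :* x :+ :- (n :* (y :* y)) :+ n :* (y :* y)) refl x y ν ⟩
        norm x y + ν ∙ (y ∙ y)      ≈⟨ +-cong eq (*-congˡ (*-cong y≈0 y≈0)) ⟩
        0# + ν ∙ (0# ∙ 0#)          ≈⟨ solve 1 (λ n → con (+ 0) :+ n :* (con (+ 0) :* con (+ 0)) := con (+ 0)) refl ν ⟩
        0#                          ∎))

    -- The affine points of the Hermitian unital, in the 7-dimensional quotient of the
    -- trace-zero Hermitian matrices of order 3 by the scalars. With i² = ν and
    -- z = z₁ + i z₂, the first coordinate pair contributes - ν y² to the form, and the
    -- next two hold z and the functional Re(conj((N(z) - i y) z) ·).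
    unital : V 3 → H 4
    unital v = [ y ∷ z₁ ∷ z₂ ∷ 0# ∷ (λ ())
               , - (ν ∙ y) ∷ norm z₁ z₂ ∙ z₁ - ν ∙ y ∙ z₂ ∷ - (ν ∙ (norm z₁ z₂ ∙ z₂ - y ∙ z₁)) ∷ 0# ∷ (λ ()) ]
      where
      y z₁ z₂ : Carrier
      y  = v zero
      z₁ = v (suc zero)
      z₂ = v (suc (suc zero))

    -- The first summand is the norm of the Hermitian product of the two unital points.
    unital-difference : ∀ y z₁ z₂ y′ z₁′ z₂′ →
      hyperbolic.form (- 1# · unital (y′ ∷ z₁′ ∷ z₂′ ∷ (λ ())) ⊕ unital (y ∷ z₁ ∷ z₂ ∷ (λ ()))) ≈
      norm (norm (z₁ - z₁′) (z₂ - z₂′)) (y - y′ + (z₂ ∙ z₁′ - z₁ ∙ z₂′)) +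
      three ∙ ((norm z₁ z₂ + norm z₁′ z₂′) ∙ (z₁ ∙ z₁′ - ν ∙ (z₂ ∙ z₂′)) + ν ∙ (y - y′) ∙ (z₂ ∙ z₁′ - z₁ ∙ z₂′)
        - (z₁ ∙ z₁′ - ν ∙ (z₂ ∙ z₂′)) ∙ (z₁ ∙ z₁′ - ν ∙ (z₂ ∙ z₂′)) - norm z₁ z₂ ∙ norm z₁′ z₂′)
    unital-difference y z₁ z₂ y′ z₁′ z₂′ = solve 7 (λ n y z₁ z₂ y′ z₁′ z₂′ →
        let N = λ x y → x :* x :+ :- (n :* (y :* y))
            ρ = z₁ :* z₁′ :+ :- (n :* (z₂ :* z₂′))
            ω = z₂ :* z₁′ :+ :- (z₁ :* z₂′)
            δ = λ s t → :- con (+ 1) :* t :+ s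
            φ₀ = λ y → :- (n :* y)
            φ₁ = λ y z₁ z₂ → N z₁ z₂ :* z₁ :+ :- (n :* y :* z₂)
            φ₂ = λ y z₁ z₂ → :- (n :* (N z₁ z₂ :* z₂ :+ :- (y :* z₁)))
        -- The left side spells out the dot product over the four coordinate pairs. The fourth pair
        -- is padding from rank 3 to rank 4, and the final zero is the empty sum.
        in δ y y′ :* δ (φ₀ y) (φ₀ y′) :+ (δ z₁ z₁′ :* δ (φ₁ y z₁ z₂) (φ₁ y′ z₁′ z₂′)
             :+ (δ z₂ z₂′ :* δ (φ₂ y z₁ z₂) (φ₂ y′ z₁′ z₂′) :+ (δ (con (+ 0)) (con (+ 0)) :* δ (con (+ 0)) (con (+ 0)) :+ con (+ 0))))
           := N (N (z₁ :+ :- z₁′) (z₂ :+ :- z₂′)) (y :+ :- y′ :+ ω)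
             :+ (con (+ 1) :+ (con (+ 1) :+ (con (+ 1) :+ con (+ 0)))) :* ((N z₁ z₂ :+ N z₁′ z₂′) :* ρ :+ n :* (y :+ :- y′) :* ω
                  :+ :- (ρ :* ρ) :+ :- (N z₁ z₂ :* N z₁′ z₂′)))
      refl ν y z₁ z₂ y′ z₁′ z₂′

    -- Modulo 3 the difference form is a norm whose first argument is the norm of z - z′. Anisotropy
    -- used twice gives z = z′, and the second argument then reduces to y - y′.
    unital-separated : ∀ v v′ → hyperbolic.form (- 1# · unital v′ ⊕ unital v) ≈ 0# → v ≋ v′
    unital-separated v v′ eq = λ { zero → y≈ ; (suc zero) → close dz₁≈0 ; (suc (suc zero)) → close dz₂≈0 }
      where
      y z₁ z₂ y′ z₁′ z₂′ : Carrier
      y   = v zero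
      z₁  = v (suc zero)
      z₂  = v (suc (suc zero))
      y′  = v′ zero
      z₁′ = v′ (suc zero)
      z₂′ = v′ (suc (suc zero))
      close : ∀ {s t} → s - t ≈ 0# → s ≈ t
      close {s} {t} d≈0 = begin
        s            ≈⟨ solve 2 (λ s t → s := s :+ :- t :+ t) refl s t ⟩
        s - t + t    ≈⟨ +-congʳ d≈0 ⟩
        0# + t       ≈⟨ +-identityˡ t ⟩
        t            ∎
      outer : norm (z₁ - z₁′) (z₂ - z₂′) ≈ 0# × y - y′ + (z₂ ∙ z₁′ - z₁ ∙ z₂′) ≈ 0#
      outer = norm-anisotropic (begin
        norm (norm (z₁ - z₁′) (z₂ - z₂′)) (y - y′ + (z₂ ∙ z₁′ - z₁ ∙ z₂′))
          ≈⟨ solve 2 (λ a e → a := a :+ con (+ 0) :* e) refl _ _ ⟩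
        norm (norm (z₁ - z₁′) (z₂ - z₂′)) (y - y′ + (z₂ ∙ z₁′ - z₁ ∙ z₂′)) + 0# ∙ _
          ≈⟨ +-congˡ (*-congʳ three≈0) ⟨
        norm (norm (z₁ - z₁′) (z₂ - z₂′)) (y - y′ + (z₂ ∙ z₁′ - z₁ ∙ z₂′)) + three ∙ _
          ≈⟨ unital-difference y z₁ z₂ y′ z₁′ z₂′ ⟨
        hyperbolic.form (- 1# · unital v′ ⊕ unital v)
          ≈⟨ eq ⟩
        0# ∎)
      dz₁≈0 : z₁ - z₁′ ≈ 0#
      dz₁≈0 = proj₁ (norm-anisotropic (proj₁ outer))
      dz₂≈0 : z₂ - z₂′ ≈ 0#
      dz₂≈0 = proj₂ (norm-anisotropic (proj₁ outer))
      y≈ : y ≈ y′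
      y≈ = close (begin
        y - y′
          -- The cross term z₂ z₁′ - z₁ z₂′ is a combination of z₁ - z₁′ and z₂ - z₂′, so it
          -- vanishes with them.
          ≈⟨ solve 6 (λ y z₁ z₂ y′ z₁′ z₂′ → y :+ :- y′
               := y :+ :- y′ :+ (z₂ :* z₁′ :+ :- (z₁ :* z₂′)) :+ :- ((z₂ :+ :- z₂′) :* z₁′) :+ (z₁ :+ :- z₁′) :* z₂′) refl y z₁ z₂ y′ z₁′ z₂′ ⟩
        y - y′ + (z₂ ∙ z₁′ - z₁ ∙ z₂′) - (z₂ - z₂′) ∙ z₁′ + (z₁ - z₁′) ∙ z₂′
          ≈⟨ +-cong (+-cong (proj₂ outer) (-‿cong (*-congʳ dz₂≈0))) (*-congʳ dz₁≈0) ⟩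
        0# - 0# ∙ z₁′ + 0# ∙ z₂′
          ≈⟨ solve 2 (λ s t → con (+ 0) :+ :- (con (+ 0) :* s) :+ con (+ 0) :* t := con (+ 0)) refl z₁′ z₂′ ⟩
        0# ∎)

  -- Pencils of a partial ovoid

  module PartialOvoid {n : ℕ} (Q : QuadraticForm (ℕ.suc n ℕ.+ ℕ.suc n)) (nondegenerate : Nondegenerate Q)
    (θ₀ : Isometry (hyperbolic (ℕ.suc n)) (ambient Q))
    {m : ℕ} (w : Fin m → H n) (separated : ∀ i j → hyperbolic.form (- 1# · w j ⊕ w i) ≈ 0# → i ≡ j) where

    private
      r : ℕ
      r = ℕ.suc n

    open Correspondence Q nondegenerate

    -- One coordinate system per point, each taking e to that point, so that `Framed` applies to
    -- every pencil.
    frames : Fin m → Isometry (hyperbolic r) (ambient Q)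
    frames i = translate {n} {Q = ambient Q} θ₀ (w i)

    module frames (i : Fin m) = Isometry (frames i)
    open module framed (i : Fin m) = Framed (frames i) using (vertex)

    vertex-orthogonal : ∀ i j → A.bil (vertex i) (vertex j) ≈ 0# → i ≡ j
    vertex-orthogonal i j ⊥ = separated i j (begin
      hyperbolic.form (- 1# · w j ⊕ w i)
        ≈⟨ solve 1 (λ f → f := :- (:- f)) refl _ ⟩
      - - hyperbolic.form (- 1# · w j ⊕ w i)
        ≈⟨ -‿cong (siegel-isotropic-bil (w i) (w j)) ⟨
      - hyperbolic.bil (Isometry.fun (siegel (w i)) isotropic) (Isometry.fun (siegel (w j)) isotropic)
        ≈⟨ -‿cong (Isometry.bil-preserving θ₀ _ _) ⟨
      - A.bil (vertex i) (vertex j)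
        ≈⟨ -‿cong ⊥ ⟩
      - 0#
        ≈⟨ solve 0 (:- con (+ 0) := con (+ 0)) refl ⟩
      0# ∎)

    vertex-unique : (π : SingularSpace Q r) → ∀ i j →
                    vertex i ∈ SingularSpace.space π → vertex j ∈ SingularSpace.space π → i ≡ j
    vertex-unique π i j i∈ j∈ = vertex-orthogonal i j
      (singular⇒orthogonal {vertex i} {vertex j} (singular _ i∈) (singular _ j∈) (singular _ (Subspace.⊕-closed space i∈ j∈)))
      where
      open SingularSpace π
      open Ambient (ambient Q)

    ray : Fin m → V 1 → V (r ℕ.+ r)
    ray i a = frames.fun i (a zero · isotropic)

    ray-linear : ∀ i → IsLinear (ray i)
    ray-linear i = ∘-isLinear {f = frames.fun i} {g = λ a → a zero · isotropic} (frames.isLinear i) record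
      { cong = λ a≋b → ·-cong {x = isotropic} (a≋b zero) ≋.refl
      ; axpy = λ s a b k → solve 4 (λ s a b e → (s :* a :+ b) :* e := s :* (a :* e) :+ b :* e) refl s (a zero) (b zero) (isotropic k)
      }

    ray-kernel : ∀ i a → ray i a ≋ 𝟎 → a ≋ 𝟎
    ray-kernel i a eq zero = trans (sym (*-identityʳ (a zero)))
      (isometry-injective {r} {Q = ambient Q} (frames i) {a zero · isotropic} {𝟎} (≋.trans eq (≋.sym (frames.𝟎-homo i))) (inj₁ zero))

    ray-singular : ∀ i a → A.form (ray i a) ≈ 0#
    ray-singular i a = begin
      A.form (ray i a)                                        ≈⟨ frames.isometric i (a zero · isotropic) ⟩
      hyperbolic.form {r} (a zero · isotropic)                ≈⟨ hyperbolic.form-· {r} (a zero) isotropic ⟩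
      a zero ∙ a zero ∙ (1# ∙ 0# + hyperbolic.form {n} 𝟎)     ≈⟨ *-congˡ (+-congˡ (hyperbolic.form-𝟎 {n})) ⟩
      a zero ∙ a zero ∙ (1# ∙ 0# + 0#)                        ≈⟨ solve 1 (λ a → a :* a :* (con (+ 1) :* con (+ 0) :+ con (+ 0)) := con (+ 0)) refl (a zero) ⟩
      0#                                                      ∎

    point : Fin m → SingularSpace Q 1
    point i = Span.spanSpace (ray-linear i) Q (ray-kernel i) (ray-singular i)

    point⊆? : ∀ i (W : Subspace (r ℕ.+ r)) → Dec (SingularSpace.space (point i) ⊆ W)
    point⊆? i W = ⊆-dec (SingularSpace.dimension (point i)) W

    vertex∈point : ∀ i → vertex i ∈ SingularSpace.space (point i)
    vertex∈point i = Span.∈-span (ray-linear i) (λ _ → 1#) (frames.cong i (λ k → *-identityˡ (isotropic k)))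

    point⊆ : ∀ i (W : Subspace (r ℕ.+ r)) → vertex i ∈ W → SingularSpace.space (point i) ⊆ W
    point⊆ i W i∈ v v∈ = let a , a↦v = Span.span-∈ (ray-linear i) v v∈ in
      ≡.subst T (Subspace.respects W (≋.trans (≋.sym (frames.·-homo i (a zero) isotropic)) a↦v)) (Subspace.·-closed W (a zero) i∈)

    Meets : SingularSpace Q r → Fin m → Set
    Meets π i = vertex i ∈ SingularSpace.space π

    meets? : ∀ π → Dec (∃ (Meets π))
    meets? π = Fin.any? {P = Meets π} (λ i → T? (member (SingularSpace.space π) (vertex i)))

    meets : SingularSpace Q r → Bool
    meets π = isYes (meets? π)

    meets-respects : ∀ {π ρ} → Setoid._≈_ (singularSpaces Q r) π ρ → meets π ≡ meets ρ
    meets-respects {π} {ρ} π≈ρ = T-extensional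
      (λ m → let i , i∈ = toWitness {a? = meets? π} m in fromWitness {a? = meets? ρ} (i , ≡.subst T (π≈ρ (vertex i)) i∈))
      (λ m → let i , i∈ = toWitness {a? = meets? ρ} m in fromWitness {a? = meets? π} (i , ≡.subst T (≡.sym (π≈ρ (vertex i))) i∈))

    meets-indicator : ∀ π → indicator (meets π) ≡
      Sum.sum ℚ.+-0-monoid (λ i → 1ℚ ℚ.* indicator (does (point⊆? i (SingularSpace.space π))))
    meets-indicator π = indicator-disjoint-union (meets π) (λ i → does (point⊆? i space))
      (λ mt → let i , i∈ = toWitness {a? = meets? π} mt in i , ⇒does (point⊆? i space) (point⊆ i space i∈))
      (λ i sub → fromWitness {a? = meets? π} (i , inside i sub))
      (λ i j i⊆ j⊆ → vertex-unique π i j (inside i i⊆) (inside j j⊆))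
      where
      open SingularSpace π
      inside : ∀ i → T (does (point⊆? i space)) → vertex i ∈ space
      inside i sub = does⇒ (point⊆? i space) sub (vertex i) (vertex∈point i)

    meeting : Setoid _ _
    meeting = On.setoid {B = Σ (SingularSpace Q r) (λ π → T (meets π))} (singularSpaces Q r) proj₁

    -- Pairs of a point and a code enumerate the union without repetition: a generator contains only
    -- one of the points, and through that point its code is unique.
    meeting-cardinality : HasCardinality meeting (m ℕ.* codeCount n)
    meeting-cardinality = cardinality-transfer {S = ≡.setoid (Fin m × Code n)} {T = meeting}
      (↔-trans (↔-refl ×-↔ codes n) (↔-sym Fin.*↔×))
      through (λ { ≡.refl _ → ≡.refl })
      (λ { {i , γ} {j , δ} eq → injective i j γ δ eq (vertex-unique (framed.generator j δ) i j
             (≡.subst T (eq (vertex i)) (framed.vertex∈generator i γ)) (framed.vertex∈generator j δ)) })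
      (λ (π , mt) → let i , i∈ = toWitness {a? = meets? π} mt
                        γ , eq = framed.generator-surjective i π i∈
                    in (i , γ) , eq)
      where
      through : Fin m × Code n → Σ (SingularSpace Q r) (λ π → T (meets π))
      through (i , γ) = framed.generator i γ , fromWitness {a? = meets? (framed.generator i γ)} (i , framed.vertex∈generator i γ)
      injective : ∀ i j γ δ → Setoid._≈_ (singularSpaces Q r) (framed.generator i γ) (framed.generator j δ) → i ≡ j → (i , γ) ≡ (j , δ)
      injective i .i γ δ eq ≡.refl = ≡.cong (i ,_) (framed.generator-injective i eq)

  generators-through-point : codeCount 4 ≡ 2 * (q ℕ.+ 1) * (q ^ 2 ℕ.+ 1) * (q ^ 3 ℕ.+ 1)
  generators-through-point = ≡.trans
    -- The second factor of `codeCount 4` contains `q ^ 1`, which computes to `q * 1`.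
    (≡.cong (λ p → 1 * 2 * ℕ.suc p * ℕ.suc (q ^ 2) * ℕ.suc (q ^ 3)) (ℕ.*-identityʳ q))
    (polynomial q (q ^ 2) (q ^ 3))
    where
    open ℕ.+-*-Solver using () renaming (solve to ℕ-solve; _:=_ to _:≡_; _:+_ to _:⊹_; _:*_ to _:×_; con to ℕ-con)
    polynomial : ∀ a b c → 1 * 2 * ℕ.suc a * ℕ.suc b * ℕ.suc c ≡ 2 * (a ℕ.+ 1) * (b ℕ.+ 1) * (c ℕ.+ 1)
    polynomial = ℕ-solve 3 (λ a b c → ℕ-con 2 :× (ℕ-con 1 :⊹ a) :× (ℕ-con 1 :⊹ b) :× (ℕ-con 1 :⊹ c)
                                   :≡ ℕ-con 2 :× (a :⊹ ℕ-con 1) :× (b :⊹ ℕ-con 1) :× (c :⊹ ℕ-con 1)) ≡.refl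

-- The Cameron-Liebler set in rank 5 over the field of order 3 ^ h

module CameronLiebler {c ℓ₁ ℓ₂ : Level} (h : ℕ) (1≤h : 1 ≤ h) (F : HeytingField c ℓ₁ ℓ₂)
  (F≅q : HasCardinality (CommutativeRing.setoid (LinearAlgebra.commutativeRing F)) (3 ^ h))
  (Q : LinearAlgebra.QuadraticForm F 10) (nondegenerate : LinearAlgebra.Nondegenerate F Q)
  (hyp : LinearAlgebra.Hyperbolic F 5 Q) where

  q : ℕ
  q = 3 ^ h

  1<q : 1 < q
  1<q = ℕ.≤-trans (ℕ.s≤s (ℕ.s≤s ℕ.z≤n)) (ℕ.^-monoʳ-≤ 3 1≤h)

  open CommutativeRing (LinearAlgebra.commutativeRing F) using (_≈_; -_; 0#; 1#)
  open FiniteField F q 1<q F≅q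
  open CharacteristicThree h ≡.refl
  open O⁺10 F Q

  x : ℕ
  x = (q ^ 2 ∸ 1) * q

  x≤q³ : x ≤ q ^ 3
  x≤q³ = ℕ.≤-trans (ℕ.*-monoˡ-≤ q (ℕ.m∸n≤m (q ^ 2) 1)) (ℕ.≤-reflexive (ℕ.*-comm (q ^ 2) q))

  -- Takes the first x of the q³ parameter triples, in the numbering given by `vectors`.
  centre : Fin x → H 4
  centre i = unital (vector {3} (inject≤ i x≤q³))

  separated : ∀ i j → hyperbolic.form (- 1# · centre j ⊕ centre i) ≈ 0# → i ≡ j
  separated i j eq = Fin.inject≤-injective x≤q³ x≤q³ i j
    (vector-injective {3} (unital-separated (vector {3} (inject≤ i x≤q³)) (vector {3} (inject≤ j x≤q³)) eq))

  open PartialOvoid {4} Q nondegenerate (Correspondence.coordinates {4} Q nondegenerate hyp) centre separated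

  pencils : GeneratorSet
  pencils = record { contains = meets ; respects = λ {π} {ρ} → meets-respects {π} {ρ} }

  pencils-cameronLiebler : IsCameronLiebler pencils
  pencils-cameronLiebler = x , (λ _ → 1ℚ) , point , meets-indicator

  pencils-parameter : HasParameter q pencils x
  pencils-parameter = ≡.subst (HasCardinality (GeneratorSet.elements pencils)) count meeting-cardinality
    where
    open ≡.≡-Reasoning
    count : x * codeCount 4 ≡ 2 * x * (q ℕ.+ 1) * (q ^ 2 ℕ.+ 1) * (q ^ 3 ℕ.+ 1)
    count = begin
      x * codeCount 4                                                ≡⟨ ≡.cong (x *_) generators-through-point ⟩
      x * (2 * (q ℕ.+ 1) * (q ^ 2 ℕ.+ 1) * (q ^ 3 ℕ.+ 1))            ≡⟨ ℕ.*-assoc x (2 * (q ℕ.+ 1) * (q ^ 2 ℕ.+ 1)) (q ^ 3 ℕ.+ 1) ⟨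
      x * (2 * (q ℕ.+ 1) * (q ^ 2 ℕ.+ 1)) * (q ^ 3 ℕ.+ 1)            ≡⟨ ≡.cong (_* (q ^ 3 ℕ.+ 1)) (ℕ.*-assoc x (2 * (q ℕ.+ 1)) (q ^ 2 ℕ.+ 1)) ⟨
      x * (2 * (q ℕ.+ 1)) * (q ^ 2 ℕ.+ 1) * (q ^ 3 ℕ.+ 1)
        ≡⟨ ≡.cong (λ m → m * (q ^ 2 ℕ.+ 1) * (q ^ 3 ℕ.+ 1)) (ℕ.*-assoc x 2 (q ℕ.+ 1)) ⟨
      x * 2 * (q ℕ.+ 1) * (q ^ 2 ℕ.+ 1) * (q ^ 3 ℕ.+ 1)
        ≡⟨ ≡.cong (λ m → m * (q ℕ.+ 1) * (q ^ 2 ℕ.+ 1) * (q ^ 3 ℕ.+ 1)) (ℕ.*-comm x 2) ⟩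
      2 * x * (q ℕ.+ 1) * (q ^ 2 ℕ.+ 1) * (q ^ 3 ℕ.+ 1)              ∎

corollary7p3 :
    {c ℓ₁ ℓ₂ : Level} (h : ℕ) → 1 ≤ h →
    (F : HeytingField c ℓ₁ ℓ₂) →
    HasCardinality (CommutativeRing.setoid (LinearAlgebra.commutativeRing F)) (3 ^ h) →
    (Q : LinearAlgebra.QuadraticForm F 10) →
    LinearAlgebra.Nondegenerate F Q →
    LinearAlgebra.Hyperbolic F 5 Q →
    let q = 3 ^ h
        open O⁺10 F Q
    in ∃[ L ] (IsCameronLiebler L × HasParameter q L ((q ^ 2 ∸ 1) * q))
corollary7p3 h 1≤h F F≅q Q nondegenerate hyp = pencils , pencils-cameronLiebler , pencils-parameter
  where open CameronLiebler h 1≤h F F≅q Q nondegenerate hyp
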